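{- For all integers $n\ge 2$, \[ b(n,2)=p(n,2)=3E(n-1,2)-2\binom{n}{3}+\binom{n}{2}-1. \]
   Context: For a permutation $\pi=\pi_1\cdots\pi_n\in S_n$, a position $i\in\{1,\dots,n-1\}$ is an ascent if $\pi_i<\pi_{i+1}$ and a descent if $\pi_i>\pi_{i+1}$. The permutation $\pi$ is called ballot if for every $1\le k\le n-1$, the number of ascents among positions $1,\dots,k$ is at least the number of descents among positions $1,\dots,k$. Let $b(n,d)$ be the number of ballot permutations in $S_n$ with exactly $d$ descents. For a cycle $\mathfrak c=(c_1,\dots,c_k)$ of a permutation (fixed points are cycles of length 1), let $\mathrm{cA}(\mathfrak c)$ be the number of $i\in\{1,\dots,k\}$ with $c_i\le c_{i+1}$ and $\mathrm{cD}(\mathfrak c)$ the number with $c_i>c_{i+1}$, where $c_{k+1}=c_1$; let $M(\mathfrak c)=\min(\mathrm{cA}(\mathfrak c),\mathrm{cD}(\mathfrak c))$, and for a permutation $\pi$ let $M(\pi)$ be the sum of $M$ over its cycles. Let $p(n,d)$ be the number of permutations in $S_n$ all of whose cycles have odd length and with $M(\pi)=d$. $E(n,d)$ denotes the Eulerian number: the number of permutations of $[n]$ with exactly $d$ descents, with $E(0,0)=1$ and $E(0,d)=0$ for $d\ge1$. -}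

module Defs where

open import Data.Nat using (ℕ; zero; suc; _+_; _∸_; _⊓_; _≤ᵇ_; _<ᵇ_; _≡ᵇ_)
open import Data.Bool using (Bool; true; false; _∧_; _∨_; not; if_then_else_)
open import Data.List using (List; []; _∷_; length; map; filter; concatMap; take)
open import Data.Product using (_×_; _,_)
open import Relation.Nullary.Decidable.Core using (T?)

range1 : ℕ → List ℕ
range1 n = go n 1
  where
  go : ℕ → ℕ → List ℕ
  go zero    _ = []
  go (suc k) s = s ∷ go k (suc s)

allB : {A : Set} → (A → Bool) → List A → Bool
allB P []       = true
allB P (x ∷ xs) = P x ∧ allB P xs

anyB : {A : Set} → (A → Bool) → List A → Bool
anyB P []       = false
anyB P (x ∷ xs) = P x ∨ anyB P xs

sumL : List ℕ → ℕ
sumL []       = 0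
sumL (x ∷ xs) = x + sumL xs

words : ℕ → ℕ → List (List ℕ)
words zero    n = [] ∷ []
words (suc k) n = concatMap (λ a → map (a ∷_) (words k n)) (range1 n)

distinct : List ℕ → Bool
distinct []       = true
distinct (x ∷ xs) = not (anyB (λ y → x ≡ᵇ y) xs) ∧ distinct xs

-- S_n in one-line notation: words of length n over [1..n] with distinct letters
perms : ℕ → List (List ℕ)
perms n = filter (λ w → T? (distinct w)) (words n n)

countPerms : ℕ → (List ℕ → Bool) → ℕ
countPerms n P = length (filter (λ w → T? (P w)) (perms n))

des : List ℕ → ℕ
des (x ∷ y ∷ zs) = (if y <ᵇ x then 1 else 0) + des (y ∷ zs)
des _            = 0

asc : List ℕ → ℕ
asc (x ∷ y ∷ zs) = (if x <ᵇ y then 1 else 0) + asc (y ∷ zs)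
asc _            = 0

-- ballot: for every 1 ≤ k ≤ n-1, among positions 1..k (i.e. within the
-- prefix π_1 … π_{k+1}) #ascents ≥ #descents
isBallot : List ℕ → Bool
isBallot w = allB (λ k → des (take (suc k) w) ≤ᵇ asc (take (suc k) w))
                  (range1 (length w ∸ 1))

E : ℕ → ℕ → ℕ
E n d = countPerms n (λ w → des w ≡ᵇ d)

b : ℕ → ℕ → ℕ
b n d = countPerms n (λ w → isBallot w ∧ (des w ≡ᵇ d))

-- π(i) for a permutation in one-line notation w (positions 1-indexed)
app : List ℕ → ℕ → ℕ
app []       _             = 0
app (x ∷ xs) zero          = 0
app (x ∷ xs) (suc zero)    = x
app (x ∷ xs) (suc (suc i)) = app xs (suc i)

-- the cycle of w through i, written (i, π(i), π²(i), …); the fuel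
-- 'length w' suffices since a cycle has at most n elements
cycleOf : List ℕ → ℕ → List ℕ
cycleOf w i = i ∷ go (length w) (app w i)
  where
  go : ℕ → ℕ → List ℕ
  go zero    _ = []
  go (suc f) j = if j ≡ᵇ i then [] else j ∷ go f (app w j)

isCycleMin : List ℕ → ℕ → Bool
isCycleMin w i = allB (λ j → i ≤ᵇ j) (cycleOf w i)

-- all cycles of w (fixed points included), each listed once,
-- starting from its minimal element
cycles : List ℕ → List (List ℕ)
cycles w = map (cycleOf w) (filter (λ i → T? (isCycleMin w i)) (range1 (length w)))

cyclicPairsFrom : ℕ → List ℕ → List (ℕ × ℕ)
cyclicPairsFrom c1 []           = []
cyclicPairsFrom c1 (x ∷ [])     = (x , c1) ∷ []
cyclicPairsFrom c1 (x ∷ y ∷ zs) = (x , y) ∷ cyclicPairsFrom c1 (y ∷ zs)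

cyclicPairs : List ℕ → List (ℕ × ℕ)
cyclicPairs []       = []
cyclicPairs (c ∷ cs) = cyclicPairsFrom c (c ∷ cs)

countB : {A : Set} → (A → Bool) → List A → ℕ
countB P []       = 0
countB P (x ∷ xs) = (if P x then 1 else 0) + countB P xs

cA : List ℕ → ℕ
cA c = countB (λ { (x , y) → x ≤ᵇ y }) (cyclicPairs c)

cD : List ℕ → ℕ
cD c = countB (λ { (x , y) → y <ᵇ x }) (cyclicPairs c)

Mcyc : List ℕ → ℕ
Mcyc c = cA c ⊓ cD c

Mperm : List ℕ → ℕ
Mperm w = sumL (map Mcyc (cycles w))

isOdd : ℕ → Bool
isOdd zero          = false
isOdd (suc zero)    = true
isOdd (suc (suc k)) = isOdd k

allCyclesOdd : List ℕ → Bool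
allCyclesOdd w = allB (λ c → isOdd (length c)) (cycles w)

p : ℕ → ℕ → ℕ
p n d = countPerms n (λ w → allCyclesOdd w ∧ (Mperm w ≡ᵇ d))

{-# OPTIONS --safe #-}
-- A permutation of [n + 1] arises from one of [n] by inserting n + 1, and two
-- insertions are used. Inserting into the one-line word changes the sequence of
-- ascents and descents by prepending D, appending A or replacing a letter by A D.
-- Inserting behind an element of a cycle turns one cyclic ascent or descent into an
-- ascent and a descent. Hence every statistic f of the ascent/descent word, and every
-- statistic of the multiset of pairs (cA, cD) of the cycles, satisfies
-- Σ_{S_{n+1}} f = Σ_{S_n} Δ f for an explicit linear operator Δ.
-- A word with two descents is ballot unless it starts with D or A D D, so b(n,2) lies
-- in a finite-dimensional Δ-invariant family. For p(n,2), each cycle that is not a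
-- fixed point contributes at least 1 to M, so at most two of them occur, and the
-- indicators needed for them again span a finite-dimensional invariant family up to
-- polynomial factors. Solving the recurrences gives combinations of 3ⁿ, n 2ⁿ and
-- polynomials; the terms (-1)ⁿ coming from one and from two nontrivial cycles cancel.
module Submission where

open import Defs
open import Data.Bool using (Bool; true; false; _∧_; not; if_then_else_; T)
open import Data.Bool.Properties using (T-∧; ∧-zeroʳ; ∧-identityʳ)
open import Data.Empty using (⊥; ⊥-elim)
open import Data.Integer using (ℤ; +_; -_; _-_; _*_; _+_; _^_)
open import Data.Integer.Properties using (+-assoc; +-comm; +-identityʳ)
import Data.Integer.Properties as ℤₚ
open import Data.Integer.Tactic.RingSolver using (solve-∀)
open import Data.List using (List; []; _∷_; [_]; _++_; _∷ʳ_; length; map; filter; concat; concatMap; take; upTo; cartesianProduct; cartesianProductWith; initLast; _∷ʳ′_)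
open import Data.List.Membership.Propositional using (_∈_; _∉_)
open import Data.List.Membership.Propositional.Properties using (∈-filter⁺; ∈-filter⁻; ∈-map⁺; ∈-map⁻; ∈-∃++; ∈-++⁺ˡ; ∈-insert; ∈-upTo⁺; ∈-upTo⁻; ∈-cartesianProduct⁺; ∈-cartesianProduct⁻; ∈-cartesianProductWith⁺; ∈-cartesianProductWith⁻; ∈-concat⁻′)
open import Data.List.Membership.Propositional.Properties.WithK using (unique∧set⇒bag)
open import Data.List.Properties using (map-upTo; upTo-∷ʳ; length-upTo; map-++; length-map; length-++; filter-++; ++-assoc; ∷-injective; ∷ʳ-injective; filter-accept; filter-reject)
open import Data.List.Relation.Binary.BagAndSetEquality using (∼bag⇒↭)
open import Data.List.Relation.Binary.Permutation.Propositional as Perm using (_↭_; ↭-refl; ↭-reflexive; ↭-sym; ↭-trans; ↭-prep; ↭-swap; ↭⇒↭ₛ)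
open import Data.List.Relation.Binary.Permutation.Propositional.Properties using (↭-length; ∈-resp-↭; All-resp-↭; shift; shifts; drop-∷; ∷↭∷ʳ; ++⁺ˡ; ++⁺ʳ; filter-↭)
import Data.List.Relation.Binary.Permutation.Propositional.Properties as Permₚ
import Data.List.Relation.Binary.Permutation.Setoid.Properties as Permₛ
open import Data.List.Relation.Unary.All as All using (All; []; _∷_)
import Data.List.Relation.Unary.All.Properties as Allₚ
open import Data.List.Relation.Unary.AllPairs using ([]; _∷_)
open import Data.List.Relation.Unary.Any using (here; there)
open import Data.List.Relation.Unary.Unique.Propositional using (Unique)
import Data.List.Relation.Unary.Unique.Propositional.Properties as Uniqueₚ
open import Data.Nat using (ℕ; zero; suc; _≤_; _<_; z≤n; s≤s; _≡ᵇ_; _<ᵇ_; _≤ᵇ_)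
import Data.Nat as ℕ
import Data.Nat.Properties as ℕₚ
open import Data.Nat.Combinatorics using (_C_; nCk+nC[k+1]≡[n+1]C[k+1]; nC1≡n)
open import Data.Product using (_×_; _,_; ∃; ∃₂; proj₁; proj₂)
open import Data.Sum using (inj₁; inj₂)
open import Relation.Binary.Definitions using (tri<; tri≈; tri>)
open import Data.Unit using (tt)
open import Function using (_∘_; id)
open import Function.Bundles using (mk⇔; Equivalence)
open import Relation.Binary.PropositionalEquality using (_≡_; _≢_; refl; sym; trans; cong; cong₂; subst; setoid; module ≡-Reasoning)
open import Relation.Nullary using (contradiction; ¬_)
open import Relation.Nullary.Decidable.Core using (T?)

-- Sums over lists

-- Parity shapes the cycle side: an insertion makes a cycle one longer, so oddness alone is not
-- preserved, and every statistic is carried together with its even counterpart. Each recurrence is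
-- thus a coupled pair built on the exchange of the two parities, and its eigenvalues are the growth
-- rates that appear. Cycles with few descents need no recurrence of their own, because insertion
-- treats ascents and descents symmetrically. The obstacle on that side is that `cycles` is a
-- fuelled search whose output is reordered by an insertion. The decomposition is therefore carried
-- as a certificate that insertions update and that determines `cycles` up to order; this is why
-- only symmetric functions are summed. The closed forms have rational coefficients. Each is stated
-- for an integer multiple of its statistic, all three quantities are compared after multiplication
-- by 12, and the factor is cancelled in ℤ at the end.

∑ : {A : Set} → List A → (A → ℤ) → ℤ
∑ []       f = + 0
∑ (x ∷ xs) f = f x + ∑ xs f

infix 5 ⟦_⟧
⟦_⟧ : Bool → ℤ
⟦ true ⟧  = + 1
⟦ false ⟧ = + 0

module _ {A : Set} where

  ∑-cong : ∀ {f g : A → ℤ} xs → (∀ {x} → x ∈ xs → f x ≡ g x) → ∑ xs f ≡ ∑ xs g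
  ∑-cong []       eq = refl
  ∑-cong (x ∷ xs) eq = cong₂ _+_ (eq (here refl)) (∑-cong xs (eq ∘ there))

  ∑-++ : ∀ (f : A → ℤ) xs ys → ∑ (xs ++ ys) f ≡ ∑ xs f + ∑ ys f
  ∑-++ f []       ys = sym (ℤₚ.+-identityˡ _)
  ∑-++ f (x ∷ xs) ys = trans (cong (_+_ (f x)) (∑-++ f xs ys)) (sym (+-assoc (f x) _ _))

  ∑-+ : ∀ (f g : A → ℤ) xs → ∑ xs (λ x → f x + g x) ≡ ∑ xs f + ∑ xs g
  ∑-+ f g []       = refl
  ∑-+ f g (x ∷ xs) rewrite ∑-+ f g xs = lemma (f x) (g x) (∑ xs f) (∑ xs g)
    where
    lemma : ∀ a b c d → (a + b) + (c + d) ≡ (a + c) + (b + d)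
    lemma = solve-∀

  ∑-* : ∀ k (f : A → ℤ) xs → ∑ xs (λ x → k * f x) ≡ k * ∑ xs f
  ∑-* k f []       = sym (ℤₚ.*-zeroʳ k)
  ∑-* k f (x ∷ xs) rewrite ∑-* k f xs = sym (ℤₚ.*-distribˡ-+ k (f x) (∑ xs f))

  ∑-map : ∀ {B : Set} (f : B → ℤ) (g : A → B) xs → ∑ (map g xs) f ≡ ∑ xs (f ∘ g)
  ∑-map f g []       = refl
  ∑-map f g (x ∷ xs) = cong (_+_ (f (g x))) (∑-map f g xs)

  ∑-↭ : ∀ (f : A → ℤ) {xs ys} → xs ↭ ys → ∑ xs f ≡ ∑ ys f
  ∑-↭ f Perm.refl           = refl
  ∑-↭ f (Perm.prep x p)     = cong (_+_ (f x)) (∑-↭ f p)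
  ∑-↭ f (Perm.swap {ys = ys} x y p) rewrite ∑-↭ f p = lemma (f x) (f y) (∑ ys f)
    where
    lemma : ∀ a b c → a + (b + c) ≡ b + (a + c)
    lemma = solve-∀
  ∑-↭ f (Perm.trans p q)    = trans (∑-↭ f p) (∑-↭ f q)

  length-filter : ∀ (P : A → Bool) xs → + length (filter (λ x → T? (P x)) xs) ≡ ∑ xs (⟦_⟧ ∘ P)
  length-filter P []       = refl
  length-filter P (x ∷ xs) with P x
  ... | true  = cong (λ k → + 1 + k) (length-filter P xs)
  ... | false = trans (length-filter P xs) (sym (ℤₚ.+-identityˡ _))

∑-cartesianProduct : ∀ {A B : Set} (f : A × B → ℤ) xs ys →
  ∑ (cartesianProduct xs ys) f ≡ ∑ xs (λ x → ∑ ys (λ y → f (x , y)))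
∑-cartesianProduct f []       ys = refl
∑-cartesianProduct f (x ∷ xs) ys = trans (∑-++ f (map (x ,_) ys) _)
  (cong₂ _+_ (∑-map f (x ,_) ys) (∑-cartesianProduct f xs ys))

countPerms-∑ : ∀ n P → + countPerms n P ≡ ∑ (perms n) (⟦_⟧ ∘ P)
countPerms-∑ n P = length-filter P (perms n)

∑-upTo-suc : ∀ (f : ℕ → ℤ) n → ∑ (upTo (suc n)) f ≡ f 0 + ∑ (upTo n) (f ∘ suc)
∑-upTo-suc f n = cong (_+_ (f 0)) (trans (cong (λ l → ∑ l f) (sym (map-upTo suc n))) (∑-map f suc (upTo n)))

-- Permutations as rearrangements of [1 … n]

from : ℕ → ℕ → List ℕ
from zero    s = []
from (suc k) s = s ∷ from k (suc s)

-- Two defining equations determine the local worker of `range1`. The leading argument `m` is the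
-- parameter that a local function inherits from its enclosing definition.
from-unique : (g : ℕ → ℕ → ℕ → List ℕ) → (∀ m s → g m 0 s ≡ []) →
  (∀ m k s → g m (suc k) s ≡ s ∷ g m k (suc s)) → ∀ m k s → g m k s ≡ from k s
from-unique g z c m zero    s = z m s
from-unique g z c m (suc k) s = trans (c m k s) (cong (s ∷_) (from-unique g z c m k (suc s)))

-- range1-go names the local function in the definition of range1: abstracting
-- its arguments makes the unification problem for it a pattern.
mutual
  range1-go : ℕ → ℕ → ℕ → List ℕ
  range1-go = _

  range1≡from : ∀ n → range1 n ≡ from n 1
  range1≡from zero    = refl
  range1≡from (suc n) with suc n | 2
  ... | m | s = cong (1 ∷_) (from-unique range1-go (λ _ _ → refl) (λ _ _ _ → refl) m n s)

from-suc : ∀ k s → from k (suc s) ≡ map suc (from k s)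
from-suc zero    s = refl
from-suc (suc k) s = cong (suc s ∷_) (from-suc k (suc s))

from≡upTo : ∀ k → from k 0 ≡ upTo k
from≡upTo zero    = refl
from≡upTo (suc k) = cong (0 ∷_)
  (trans (from-suc k 0) (trans (cong (map suc) (from≡upTo k)) (map-upTo suc k)))

range1≡map-upTo : ∀ n → range1 n ≡ map suc (upTo n)
range1≡map-upTo n = trans (range1≡from n) (trans (from-suc n 0) (cong (map suc) (from≡upTo n)))

length-range1 : ∀ n → length (range1 n) ≡ n
length-range1 n rewrite range1≡map-upTo n = trans (length-map suc (upTo n)) (length-upTo n)

range1-unique : ∀ n → Unique (range1 n)
range1-unique n rewrite range1≡map-upTo n = Uniqueₚ.map⁺ ℕₚ.suc-injective (Uniqueₚ.upTo⁺ n)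

range1-suc : ∀ n → range1 (suc n) ≡ range1 n ∷ʳ suc n
range1-suc n rewrite range1≡map-upTo n | range1≡map-upTo (suc n) =
  trans (cong (map suc) (sym (upTo-∷ʳ n))) (map-++ suc (upTo n) [ n ])

range1-suc-↭ : ∀ n → suc n ∷ range1 n ↭ range1 (suc n)
range1-suc-↭ n rewrite range1-suc n = ∷↭∷ʳ (suc n) (range1 n)

∈-range1⁻ : ∀ {n x} → x ∈ range1 n → ∃ λ k → x ≡ suc k × k < n
∈-range1⁻ {n} x∈ rewrite range1≡map-upTo n with ∈-map⁻ suc x∈
... | k , k∈ , eq = k , eq , ∈-upTo⁻ k∈

∈-range1⁺ : ∀ {n k} → k < n → suc k ∈ range1 n
∈-range1⁺ {n} k<n rewrite range1≡map-upTo n = ∈-map⁺ suc (∈-upTo⁺ k<n)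

suc∉range1 : ∀ n → suc n ∉ range1 n
suc∉range1 n n∈ with ∈-range1⁻ {n} n∈
... | k , refl , k<n = ℕₚ.<-irrefl refl k<n

Unique-resp-↭ : ∀ {A : Set} {xs ys : List A} → xs ↭ ys → Unique xs → Unique ys
Unique-resp-↭ {A} p = Permₛ.Unique-resp-↭ (setoid A) (↭⇒↭ₛ p)

-- Pigeonhole, by removing the head of `xs` from both lists. It shows that n distinct letters from
-- [1 ... n] use every letter.
Unique-⊆⇒↭ : ∀ {A : Set} (xs ys : List A) → Unique xs → (∀ {x} → x ∈ xs → x ∈ ys) →
  length xs ≡ length ys → xs ↭ ys
Unique-⊆⇒↭ []       []      u sub eq = ↭-refl
Unique-⊆⇒↭ (x ∷ xs) ys (x∉ ∷ u) sub eq with ∈-∃++ (sub (here refl))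
... | as , bs , refl = ↭-trans (↭-prep x (Unique-⊆⇒↭ xs (as ++ bs) u sub′ eq′)) (↭-sym (shift x as bs))
  where
  eq′ : length xs ≡ length (as ++ bs)
  eq′ = ℕₚ.suc-injective (trans eq (↭-length (shift x as bs)))
  sub′ : ∀ {y} → y ∈ xs → y ∈ as ++ bs
  sub′ y∈ with ∈-resp-↭ (shift x as bs) (sub (there y∈))
  ... | here refl = contradiction refl (All.lookup x∉ y∈)
  ... | there y∈′ = y∈′

not-anyB⇒All≢ : ∀ x xs → T (not (anyB (λ y → x ≡ᵇ y) xs)) → All (x ≢_) xs
not-anyB⇒All≢ x []       t = []
not-anyB⇒All≢ x (y ∷ ys) t with x ≡ᵇ y in eq
... | false = (λ x≡y → subst T eq (ℕₚ.≡⇒≡ᵇ x y x≡y)) ∷ not-anyB⇒All≢ x ys t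

All≢⇒not-anyB : ∀ {x xs} → All (x ≢_) xs → T (not (anyB (λ y → x ≡ᵇ y) xs))
All≢⇒not-anyB []         = tt
All≢⇒not-anyB {x} {y ∷ _} (x≢y ∷ ps) with x ≡ᵇ y in eq
... | true  = x≢y (ℕₚ.≡ᵇ⇒≡ x y (subst T (sym eq) tt))
... | false = All≢⇒not-anyB ps

distinct⇒Unique : ∀ w → T (distinct w) → Unique w
distinct⇒Unique []       t = []
distinct⇒Unique (x ∷ xs) t with Equivalence.to T-∧ t
... | t₁ , t₂ = not-anyB⇒All≢ x xs t₁ ∷ distinct⇒Unique xs t₂

Unique⇒distinct : ∀ {w} → Unique w → T (distinct w)
Unique⇒distinct []       = tt
Unique⇒distinct (x∉ ∷ u) = Equivalence.from T-∧ (All≢⇒not-anyB x∉ , Unique⇒distinct u)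

words-suc : ∀ k n → words (suc k) n ≡ cartesianProductWith _∷_ (range1 n) (words k n)
words-suc k n = go (range1 n)
  where
  go : ∀ xs → concatMap (λ a → map (a ∷_) (words k n)) xs ≡ cartesianProductWith _∷_ xs (words k n)
  go []       = refl
  go (x ∷ xs) = cong (map (x ∷_) (words k n) ++_) (go xs)

words-unique : ∀ k n → Unique (words k n)
words-unique zero    n = [] ∷ []
words-unique (suc k) n rewrite words-suc k n =
  Uniqueₚ.cartesianProductWith⁺ _∷_ ∷-injective (range1-unique n) (words-unique k n)

∈-words⁺ : ∀ {n} w → All (_∈ range1 n) w → w ∈ words (length w) n
∈-words⁺         []      []       = here refl
∈-words⁺ {n} (x ∷ w) (x∈ ∷ w∈) rewrite words-suc (length w) n =
  ∈-cartesianProductWith⁺ _∷_ x∈ (∈-words⁺ w w∈)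

∈-words⁻ : ∀ k {n} w → w ∈ words k n → length w ≡ k × All (_∈ range1 n) w
∈-words⁻ zero    w (here refl) = refl , []
∈-words⁻ (suc k) {n} w w∈ rewrite words-suc k n
  with ∈-cartesianProductWith⁻ _∷_ (range1 n) (words k n) w∈
... | x , v , x∈ , v∈ , refl with ∈-words⁻ k v v∈
... | eq , all = cong suc eq , x∈ ∷ all

perms-unique : ∀ n → Unique (perms n)
perms-unique n = Uniqueₚ.filter⁺ (λ w → T? (distinct w)) (words-unique n n)

∈-perms⁺ : ∀ {n w} → w ↭ range1 n → w ∈ perms n
∈-perms⁺ {n} {w} w↭ = ∈-filter⁺ (λ v → T? (distinct v))
  (subst (λ k → w ∈ words k n) (trans (↭-length w↭) (length-range1 n))
    (∈-words⁺ w (All.tabulate (∈-resp-↭ w↭))))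
  (Unique⇒distinct (Unique-resp-↭ (↭-sym w↭) (range1-unique n)))

∈-perms⁻ : ∀ {n w} → w ∈ perms n → w ↭ range1 n
∈-perms⁻ {n} {w} w∈ with ∈-filter⁻ (λ v → T? (distinct v)) {xs = words n n} w∈
... | w∈words , d with ∈-words⁻ n w w∈words
... | len , all = Unique-⊆⇒↭ w (range1 n) (distinct⇒Unique w d) (All.lookup all)
  (trans len (sym (length-range1 n)))

length-perm : ∀ {n w} → w ∈ perms n → length w ≡ n
length-perm {n} w∈ = trans (↭-length (∈-perms⁻ {n} w∈)) (length-range1 n)

-- Insertion of a new maximum

-- Common core of the two insertions: each is a bijection from pairs of a permutation in S_n and a
-- place k ≤ n onto S_{n+1}. Injectivity is supplied by the retraction `ret`, surjectivity by
-- `ins-onto`.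
module Insertion
  (ins : ℕ → ℕ → List ℕ → List ℕ)
  (ret : ℕ → List ℕ → ℕ × List ℕ)
  (ins-↭ : ∀ N k w → ins N k w ↭ N ∷ w)
  (ret-ins : ∀ {N k w} → N ∉ w → k ≤ length w → ret N (ins N k w) ≡ (k , w))
  (ins-onto : ∀ {N v} → N ∈ v → ∃₂ λ k w → k ≤ length w × v ≡ ins N k w)
  where

  private
    pairs : ℕ → List (List ℕ × ℕ)
    pairs n = cartesianProduct (perms n) (upTo (suc n))

    ins′ : ℕ → List ℕ × ℕ → List ℕ
    ins′ n (w , k) = ins (suc n) k w

    ret′ : ℕ → List ℕ → List ℕ × ℕ
    ret′ n v = proj₂ (ret (suc n) v) , proj₁ (ret (suc n) v)

    ret′-ins′ : ∀ n (ps : List (List ℕ × ℕ)) → (∀ {q} → q ∈ ps → q ∈ pairs n) → map (ret′ n) (map (ins′ n) ps) ≡ ps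
    ret′-ins′ n []             sub = refl
    ret′-ins′ n ((w , k) ∷ ps) sub with ∈-cartesianProduct⁻ (perms n) (upTo (suc n)) (sub (here refl))
    ... | w∈ , k∈ = cong₂ _∷_ (cong (λ (i , v) → v , i) (ret-ins N∉ k≤)) (ret′-ins′ n ps (sub ∘ there))
      where
      w↭ = ∈-perms⁻ {n} w∈
      N∉ : suc n ∉ w
      N∉ = suc∉range1 n ∘ ∈-resp-↭ w↭
      k≤ : k ≤ length w
      k≤ = subst (k ≤_) (sym (length-perm {n} w∈)) (ℕₚ.≤-pred (∈-upTo⁻ k∈))

  perms-suc⁻ : ∀ {n v} → v ∈ perms (suc n) → ∃₂ λ k w → k ≤ n × w ∈ perms n × v ≡ ins (suc n) k w
  perms-suc⁻ {n} v∈ with v↭ ← ∈-perms⁻ {suc n} v∈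
                    with ins-onto (∈-resp-↭ (↭-trans (range1-suc-↭ n) (↭-sym v↭)) (here refl))
  ... | k , w , k≤ , refl = k , w , subst (k ≤_) (length-perm {n} w∈) k≤ , w∈ , refl
    where
    w∈ : w ∈ perms n
    w∈ = ∈-perms⁺ (drop-∷ (↭-trans (↭-sym (ins-↭ (suc n) k w)) (↭-trans v↭ (↭-sym (range1-suc-↭ n)))))

  private
    -- Duplicate-free lists with the same elements are rearrangements of each other. The right-hand
    -- list is duplicate-free because its image under `ret′` is `pairs n`.
    inserted : ∀ n → perms (suc n) ↭ map (ins′ n) (pairs n)
    inserted n = ∼bag⇒↭ (unique∧set⇒bag (perms-unique (suc n))
      (Uniqueₚ.map⁻ (subst Unique (sym (ret′-ins′ n (pairs n) id))
        (Uniqueₚ.cartesianProduct⁺ (perms-unique n) (Uniqueₚ.upTo⁺ (suc n)))))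
      (mk⇔ to from′))
      where
      to : ∀ {v} → v ∈ perms (suc n) → v ∈ map (ins′ n) (pairs n)
      to v∈ with perms-suc⁻ {n} v∈
      ... | k , w , k≤ , w∈ , refl = ∈-map⁺ (ins′ n) (∈-cartesianProduct⁺ w∈ (∈-upTo⁺ (s≤s k≤)))
      from′ : ∀ {v} → v ∈ map (ins′ n) (pairs n) → v ∈ perms (suc n)
      from′ v∈ with ∈-map⁻ (ins′ n) v∈
      ... | (w , k) , wk∈ , refl with ∈-cartesianProduct⁻ (perms n) (upTo (suc n)) wk∈
      ... | w∈ , _ = ∈-perms⁺ {suc n} (↭-trans (ins-↭ (suc n) k w)
              (↭-trans (↭-prep (suc n) (∈-perms⁻ {n} w∈)) (range1-suc-↭ n)))

  ∑-perms-suc : ∀ n F → ∑ (perms (suc n)) F ≡ ∑ (perms n) (λ w → ∑ (upTo (suc n)) (λ k → F (ins (suc n) k w)))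
  ∑-perms-suc n F = trans (∑-↭ F (inserted n))
    (trans (∑-map F (ins′ n) (pairs n)) (∑-cartesianProduct (F ∘ ins′ n) (perms n) (upTo (suc n))))

-- Signatures and ballot permutations

delete : ℕ → List ℕ → ℕ × List ℕ
delete N []       = 0 , []
delete N (x ∷ xs) = if x ≡ᵇ N then (0 , xs) else (let (k , ys) = delete N xs in suc k , x ∷ ys)

insL : ℕ → ℕ → List ℕ → List ℕ
insL N zero    w       = N ∷ w
insL N (suc k) []      = [ N ]
insL N (suc k) (x ∷ w) = x ∷ insL N k w

≡ᵇ-refl : ∀ n → (n ≡ᵇ n) ≡ true
≡ᵇ-refl zero    = refl
≡ᵇ-refl (suc n) = ≡ᵇ-refl n

≢⇒≡ᵇ-false : ∀ {m n} → m ≢ n → (m ≡ᵇ n) ≡ false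
≢⇒≡ᵇ-false {m} {n} m≢n with m ≡ᵇ n in eq
... | true  = contradiction (ℕₚ.≡ᵇ⇒≡ m n (subst T (sym eq) tt)) m≢n
... | false = refl

insL-↭ : ∀ N k w → insL N k w ↭ N ∷ w
insL-↭ N zero    w       = ↭-refl
insL-↭ N (suc k) []      = ↭-refl
insL-↭ N (suc k) (x ∷ w) = ↭-trans (↭-prep x (insL-↭ N k w)) (↭-swap x N ↭-refl)

delete-insL : ∀ {N k w} → N ∉ w → k ≤ length w → delete N (insL N k w) ≡ (k , w)
delete-insL {N} {zero}          N∉ _ rewrite ≡ᵇ-refl N = refl
delete-insL {N} {suc k} {x ∷ w} N∉ (s≤s k≤)
  rewrite ≢⇒≡ᵇ-false {x} {N} (λ eq → N∉ (here (sym eq))) | delete-insL {N} {k} {w} (N∉ ∘ there) k≤ = refl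

insL-onto : ∀ {N v} → N ∈ v → ∃₂ λ k w → k ≤ length w × v ≡ insL N k w
insL-onto {v = _ ∷ v} (here refl) = 0 , v , z≤n , refl
insL-onto {v = x ∷ v} (there N∈) with insL-onto N∈
... | k , w , k≤ , refl = suc k , x ∷ w , s≤s k≤ , refl

module Linear = Insertion insL delete insL-↭ delete-insL insL-onto

sig : List ℕ → List Bool
sig (x ∷ y ∷ zs) = (y <ᵇ x) ∷ sig (y ∷ zs)
sig _            = []

pattern D = true
pattern A = false

-- Inserting a new maximum into a word with signature s prepends D, appends A,
-- or replaces one letter by A D; Δ sums f over all results, Δ′ over all but the first.
Δ′ : (List Bool → ℤ) → List Bool → ℤ
Δ′ f []      = f [ A ]
Δ′ f (c ∷ s) = f (A ∷ D ∷ s) + Δ′ (λ t → f (c ∷ t)) s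

Δ : (List Bool → ℤ) → List Bool → ℤ
Δ f s = f (D ∷ s) + Δ′ f s

<⇒<ᵇ-true : ∀ {m n} → m < n → (m <ᵇ n) ≡ true
<⇒<ᵇ-true {m} {n} m<n with m <ᵇ n in eq
... | true  = refl
... | false = ⊥-elim (subst T eq (ℕₚ.<⇒<ᵇ m<n))

≥⇒<ᵇ-false : ∀ {m n} → n ≤ m → (m <ᵇ n) ≡ false
≥⇒<ᵇ-false {m} {n} n≤m with m <ᵇ n in eq
... | false = refl
... | true  = contradiction (ℕₚ.<ᵇ⇒< m n (subst T (sym eq) tt)) (ℕₚ.≤⇒≯ n≤m)

∑-insL-tail : ∀ N x xs (f : List Bool → ℤ) → All (_< N) (x ∷ xs) →
  ∑ (upTo (suc (length xs))) (λ k → f (sig (x ∷ insL N k xs))) ≡ Δ′ f (sig (x ∷ xs))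
∑-insL-tail N x [] f (x<N ∷ []) rewrite ≥⇒<ᵇ-false (ℕₚ.<⇒≤ x<N) = +-identityʳ _
∑-insL-tail N x (y ∷ ys) f (x<N ∷ y<N ∷ ys<N) =
  trans (∑-upTo-suc (λ k → f (sig (x ∷ insL N k (y ∷ ys)))) (suc (length ys)))
    (cong₂ _+_ head (∑-insL-tail N y ys (λ t → f ((y <ᵇ x) ∷ t)) (y<N ∷ ys<N)))
  where
  head : f (sig (x ∷ N ∷ y ∷ ys)) ≡ f (A ∷ D ∷ sig (y ∷ ys))
  head rewrite ≥⇒<ᵇ-false (ℕₚ.<⇒≤ x<N) | <⇒<ᵇ-true y<N = refl

∑-insL : ∀ N x xs (f : List Bool → ℤ) → All (_< N) (x ∷ xs) →
  ∑ (upTo (suc (length (x ∷ xs)))) (λ k → f (sig (insL N k (x ∷ xs)))) ≡ Δ f (sig (x ∷ xs))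
∑-insL N x xs f all@(x<N ∷ _) =
  trans (∑-upTo-suc (λ k → f (sig (insL N k (x ∷ xs)))) (suc (length xs)))
    (cong₂ _+_ head (∑-insL-tail N x xs f all))
  where
  head : f (sig (N ∷ x ∷ xs)) ≡ f (D ∷ sig (x ∷ xs))
  head rewrite <⇒<ᵇ-true x<N = refl

length-sig : ∀ x xs → length (sig (x ∷ xs)) ≡ length xs
length-sig x []       = refl
length-sig x (y ∷ ys) = cong suc (length-sig y ys)

perm-< : ∀ {n w} → w ∈ perms n → All (_< suc n) w
perm-< {n} w∈ = All.tabulate (λ x∈ → bound (∈-range1⁻ (∈-resp-↭ (∈-perms⁻ {n} w∈) x∈)))
  where
  bound : ∀ {x} → (∃ λ k → x ≡ suc k × k < n) → x < suc n
  bound (k , refl , k<n) = s≤s k<n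

-- S m refers to the permutations of [m + 1].
S : ℕ → (List Bool → ℤ) → ℤ
S m f = ∑ (perms (suc m)) (f ∘ sig)

S-suc : ∀ m f → S (suc m) f ≡ S m (Δ f)
S-suc m f = trans (Linear.∑-perms-suc (suc m) (f ∘ sig)) (∑-cong (perms (suc m)) step)
  where
  step : ∀ {w} → w ∈ perms (suc m) →
    ∑ (upTo (suc (suc m))) (λ k → f (sig (insL (suc (suc m)) k w))) ≡ Δ f (sig w)
  step {[]}     w∈ with () ← length-perm {suc m} w∈
  step {x ∷ xs} w∈ = subst
    (λ l → ∑ (upTo (suc l)) (λ k → f (sig (insL (suc (suc m)) k (x ∷ xs)))) ≡ Δ f (sig (x ∷ xs)))
    (length-perm {suc m} w∈) (∑-insL (suc (suc m)) x xs f (perm-< {suc m} w∈))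

-- Only signatures of length m occur, so coefficients such as `+ length s` become constants that
-- `S-*` can pull out of the sum.
S-cong : ∀ m {f g} → (∀ s → length s ≡ m → f s ≡ g s) → S m f ≡ S m g
S-cong m {f} {g} eq = ∑-cong (perms (suc m)) step
  where
  step : ∀ {w} → w ∈ perms (suc m) → f (sig w) ≡ g (sig w)
  step {[]}     w∈ with () ← length-perm {suc m} w∈
  step {x ∷ xs} w∈ = eq _ (trans (length-sig x xs) (ℕₚ.suc-injective (length-perm {suc m} w∈)))

S-+ : ∀ m f g → S m (λ s → f s + g s) ≡ S m f + S m g
S-+ m f g = ∑-+ (f ∘ sig) (g ∘ sig) (perms (suc m))

S-* : ∀ m k f → S m (λ s → k * f s) ≡ k * S m f
S-* m k f = ∑-* k (f ∘ sig) (perms (suc m))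

-- Eulerian recurrences for words with exactly k descents

d : ℕ → List Bool → ℤ
d k       (A ∷ s) = d k s
d zero    (D ∷ s) = + 0
d (suc k) (D ∷ s) = d k s
d zero    []      = + 1
d (suc k) []      = + 0

Δ′-zero : ∀ s → Δ′ (λ _ → + 0) s ≡ + 0
Δ′-zero []      = refl
Δ′-zero (c ∷ s) = cong (λ z → + 0 + z) (Δ′-zero s)

Δ′-d₀ : ∀ s → Δ′ (d 0) s ≡ d 0 s
Δ′-d₀ []      = refl
Δ′-d₀ (A ∷ s) rewrite Δ′-d₀ s = ℤₚ.+-identityˡ (d 0 s)
Δ′-d₀ (D ∷ s) rewrite Δ′-zero s = refl

Δ′-d₁ : ∀ s → Δ′ (d 1) s ≡ + 2 * d 1 s + + length s * d 0 s
Δ′-d₁ []      = refl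
Δ′-d₁ (A ∷ s) rewrite Δ′-d₁ s = lemma (d 1 s) (d 0 s) (+ length s)
  where
  lemma : ∀ x y l → y + (+ 2 * x + l * y) ≡ + 2 * x + (+ 1 + l) * y
  lemma = solve-∀
Δ′-d₁ (D ∷ s) rewrite Δ′-d₀ s = lemma (d 0 s) (+ length s)
  where
  lemma : ∀ y l → y + y ≡ + 2 * y + (+ 1 + l) * + 0
  lemma = solve-∀

-- The summand `d 1 s` comes from the prepended D, so the left side is `Δ (d 2) s`. With this term
-- the coefficient is `length s`; `Δ′ (d 2)` alone would give one less.
Δ′-d₂ : ∀ s → d 1 s + Δ′ (d 2) s ≡ + 3 * d 2 s + + length s * d 1 s
Δ′-d₂ []      = refl
Δ′-d₂ (A ∷ s) = trans (cong (_+_ (d 1 s)) (Δ′-d₂ s)) (lemma (d 2 s) (d 1 s) (+ length s))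
  where
  lemma : ∀ x y l → y + (+ 3 * x + l * y) ≡ + 3 * x + (+ 1 + l) * y
  lemma = solve-∀
Δ′-d₂ (D ∷ s) rewrite Δ′-d₁ s = lemma (d 1 s) (d 0 s) (+ length s)
  where
  lemma : ∀ x y l → y + (x + (+ 2 * x + l * y)) ≡ + 3 * x + (+ 1 + l) * y
  lemma = solve-∀

-- Conditions on the first letters of a signature

δD δA : (List Bool → ℤ) → List Bool → ℤ
δD f (D ∷ s) = f s
δD f _       = + 0
δA f (A ∷ s) = f s
δA f _       = + 0

-- Replacing the leading letter by A D puts A in front, which `δD` annihilates; only insertions
-- further right survive, and they leave the leading D alone.
Δ′-δD : ∀ f s → Δ′ (δD f) s ≡ δD (Δ′ f) s
Δ′-δD f []      = refl
Δ′-δD f (A ∷ s) = trans (ℤₚ.+-identityˡ _) (Δ′-zero s)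
Δ′-δD f (D ∷ s) = ℤₚ.+-identityˡ _

-- A result starts with A if the leading letter, of either kind, was replaced by A D, or if a
-- leading A was kept. Appending A to the empty word is the one further source, and `f [] ≡ + 0`
-- removes its contribution.
Δ-δA : ∀ f s → f [] ≡ + 0 → Δ (δA f) s ≡ δA (λ t → f (D ∷ t) + Δ′ f t) s + δD (λ t → f (D ∷ t)) s
Δ-δA f []      f[] rewrite f[] = refl
Δ-δA f (A ∷ s) f[] = lemma (f (D ∷ s)) (Δ′ f s)
  where
  lemma : ∀ x y → + 0 + (x + y) ≡ (x + y) + + 0
  lemma = solve-∀
Δ-δA f (D ∷ s) f[] rewrite Δ′-zero s = lemma (f (D ∷ s))
  where
  lemma : ∀ x → + 0 + (x + + 0) ≡ + 0 + x
  lemma = solve-∀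

des≡ᵇ : ∀ w k → ⟦ des w ≡ᵇ k ⟧ ≡ d k (sig w)
des≡ᵇ []       zero    = refl
des≡ᵇ []       (suc k) = refl
des≡ᵇ (x ∷ []) zero    = refl
des≡ᵇ (x ∷ []) (suc k) = refl
des≡ᵇ (x ∷ y ∷ zs) k with y <ᵇ x | des≡ᵇ (y ∷ zs)
des≡ᵇ (x ∷ y ∷ zs) k       | A | ih = ih k
des≡ᵇ (x ∷ y ∷ zs) zero    | D | ih = refl
des≡ᵇ (x ∷ y ∷ zs) (suc k) | D | ih = ih k

-- The ballot condition, with m descents and a ascents already read

balanced : ℕ → ℕ → List Bool → Bool
balanced m a []      = true
balanced m a (A ∷ s) = (m ≤ᵇ suc a) ∧ balanced m (suc a) s
balanced m a (D ∷ s) = (suc m ≤ᵇ a) ∧ balanced (suc m) a s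

allB-cong : ∀ {P Q : ℕ → Bool} xs → (∀ k → P k ≡ Q k) → allB P xs ≡ allB Q xs
allB-cong []       eq = refl
allB-cong (x ∷ xs) eq = cong₂ _∧_ (eq x) (allB-cong xs eq)

allB-map : ∀ (P : ℕ → Bool) xs → allB P (map suc xs) ≡ allB (P ∘ suc) xs
allB-map P []       = refl
allB-map P (x ∷ xs) = cong (P (suc x) ∧_) (allB-map P xs)

-- Distinctness matters because a signature records two equal neighbours as A, whereas `asc` does
-- not count them.
balanced-sig : ∀ m a x xs → Unique (x ∷ xs) →
  allB (λ k → (m ℕ.+ des (take (suc k) (x ∷ xs))) ≤ᵇ (a ℕ.+ asc (take (suc k) (x ∷ xs)))) (from (length xs) 1)
    ≡ balanced m a (sig (x ∷ xs))
balanced-sig m a x []       u = refl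
balanced-sig m a x (y ∷ ys) ((x≢y ∷ _) ∷ u) rewrite from-suc (length ys) 1
  | allB-map (λ k → (m ℕ.+ des (take (suc k) (x ∷ y ∷ ys))) ≤ᵇ (a ℕ.+ asc (take (suc k) (x ∷ y ∷ ys)))) (from (length ys) 1)
  with ℕₚ.<-cmp x y
... | tri≈ _ x≡y _ = contradiction x≡y x≢y
... | tri< x<y _ _ rewrite <⇒<ᵇ-true x<y | ≥⇒<ᵇ-false (ℕₚ.<⇒≤ x<y) =
  cong₂ _∧_ (cong₂ _≤ᵇ_ (ℕₚ.+-identityʳ m) (ℕₚ.+-comm a 1))
    (trans (allB-cong (from (length ys) 1) (λ k → cong ((m ℕ.+ des (y ∷ take k ys)) ≤ᵇ_) (ℕₚ.+-suc a _)))
      (balanced-sig m (suc a) y ys u))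
... | tri> _ _ y<x rewrite <⇒<ᵇ-true y<x | ≥⇒<ᵇ-false (ℕₚ.<⇒≤ y<x) =
  cong₂ _∧_ (cong₂ _≤ᵇ_ (ℕₚ.+-comm m 1) (ℕₚ.+-identityʳ a))
    (trans (allB-cong (from (length ys) 1) (λ k → cong (_≤ᵇ (a ℕ.+ asc (y ∷ take k ys))) (ℕₚ.+-suc m _)))
      (balanced-sig (suc m) a y ys u))

isBallot≡balanced : ∀ x xs → Unique (x ∷ xs) → isBallot (x ∷ xs) ≡ balanced 0 0 (sig (x ∷ xs))
isBallot≡balanced x xs u rewrite range1≡from (length xs) = balanced-sig 0 0 x xs u

≤⇒≤ᵇ-true : ∀ {m n} → m ≤ n → (m ≤ᵇ n) ≡ true
≤⇒≤ᵇ-true {m} {n} m≤n with m ≤ᵇ n in eq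
... | true  = refl
... | false = ⊥-elim (subst T eq (ℕₚ.≤⇒≤ᵇ m≤n))

-- A lead of k ascents cannot be exhausted by a remainder with k descents, so the ballot test is
-- automatic on the support of `d k`.
balanced-surplus : ∀ k m a s → m ℕ.+ k ≤ a → ⟦ balanced m a s ⟧ * d k s ≡ d k s
balanced-surplus k m a [] le = ℤₚ.*-identityˡ _
balanced-surplus k m a (A ∷ s) le
  rewrite ≤⇒≤ᵇ-true (ℕₚ.m≤n⇒m≤1+n (ℕₚ.m+n≤o⇒m≤o m le)) = balanced-surplus k m (suc a) s (ℕₚ.m≤n⇒m≤1+n le)
balanced-surplus zero m a (D ∷ s) le = ℤₚ.*-zeroʳ ⟦ balanced m a (D ∷ s) ⟧
balanced-surplus (suc k) m a (D ∷ s) le with le′ ← subst (_≤ a) (ℕₚ.+-suc m k) le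
  rewrite <⇒<ᵇ-true (ℕₚ.m+n≤o⇒m≤o (suc m) le′) = balanced-surplus k (suc m) a s le′

-- A word with two descents fails to be ballot exactly when it starts with D or with A D D.
balanced-d₂ : ∀ s → ⟦ balanced 0 0 s ⟧ * d 2 s + δD (d 1) s + δA (δD (δD (d 0))) s ≡ d 2 s
balanced-d₂ []              = refl
balanced-d₂ (D ∷ s)         = lemma (d 1 s)
  where
  lemma : ∀ x → + 0 * x + x + + 0 ≡ x
  lemma = solve-∀
balanced-d₂ (A ∷ [])        = refl
balanced-d₂ (A ∷ A ∷ s)     rewrite balanced-surplus 2 0 2 s ℕₚ.≤-refl = lemma (d 2 s)
  where
  lemma : ∀ x → x + + 0 + + 0 ≡ x
  lemma = solve-∀
balanced-d₂ (A ∷ D ∷ [])    = refl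
balanced-d₂ (A ∷ D ∷ A ∷ s) rewrite balanced-surplus 1 1 2 s ℕₚ.≤-refl = lemma (d 1 s)
  where
  lemma : ∀ x → x + + 0 + + 0 ≡ x
  lemma = solve-∀
balanced-d₂ (A ∷ D ∷ D ∷ s) = lemma (d 0 s)
  where
  lemma : ∀ x → + 0 * x + + 0 + x ≡ x
  lemma = solve-∀

⟦∧⟧ : ∀ x y → ⟦ x ∧ y ⟧ ≡ ⟦ x ⟧ * ⟦ y ⟧
⟦∧⟧ true  y = sym (ℤₚ.*-identityˡ ⟦ y ⟧)
⟦∧⟧ false y = sym (ℤₚ.*-zeroˡ ⟦ y ⟧)

E-S : ∀ m k → + E (suc m) k ≡ S m (d k)
E-S m k = trans (countPerms-∑ (suc m) (λ w → des w ≡ᵇ k)) (∑-cong (perms (suc m)) (λ {w} _ → des≡ᵇ w k))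

b-S : ∀ m → + b (suc m) 2 + S m (δD (d 1)) + S m (δA (δD (δD (d 0)))) ≡ S m (d 2)
b-S m = trans
  (cong (λ z → z + S m (δD (d 1)) + S m (δA (δD (δD (d 0)))))
    (trans (countPerms-∑ (suc m) (λ w → isBallot w ∧ (des w ≡ᵇ 2))) (∑-cong (perms (suc m)) step)))
  (trans (sym (trans (S-+ m (λ s → ballot₂ s + δD (d 1) s) (δA (δD (δD (d 0))))) (cong (_+ S m (δA (δD (δD (d 0))))) (S-+ m ballot₂ (δD (d 1))))))
    (S-cong m (λ s _ → balanced-d₂ s)))
  where
  ballot₂ : List Bool → ℤ
  ballot₂ s = ⟦ balanced 0 0 s ⟧ * d 2 s
  step : ∀ {w} → w ∈ perms (suc m) → ⟦ isBallot w ∧ (des w ≡ᵇ 2) ⟧ ≡ ballot₂ (sig w)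
  step {[]}     w∈ with () ← length-perm {suc m} w∈
  step {x ∷ xs} w∈ rewrite isBallot≡balanced x xs (Unique-resp-↭ (↭-sym (∈-perms⁻ {suc m} w∈)) (range1-unique (suc m))) =
    trans (⟦∧⟧ (balanced 0 0 (sig (x ∷ xs))) _) (cong (⟦ balanced 0 0 (sig (x ∷ xs)) ⟧ *_) (des≡ᵇ (x ∷ xs) 2))

-- Insertion of a new maximum into the cycles

-- The letter at position k + 1 is replaced by N and moved to the new last position. With N the new
-- length this gives k + 1 ↦ N ↦ π(k + 1), so N follows k + 1 in its cycle; for k equal to the old
-- length, N becomes a fixed point.
insC : ℕ → ℕ → List ℕ → List ℕ
insC N k       []       = [ N ]
insC N zero    (x ∷ xs) = N ∷ (xs ∷ʳ x)
insC N (suc k) (x ∷ xs) = x ∷ insC N k xs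

insC-↭ : ∀ N k w → insC N k w ↭ N ∷ w
insC-↭ N k       []       = ↭-refl
insC-↭ N zero    (x ∷ xs) = ↭-prep N (↭-sym (∷↭∷ʳ x xs))
insC-↭ N (suc k) (x ∷ xs) = ↭-trans (↭-prep x (insC-↭ N k xs)) (↭-swap x N ↭-refl)

rotate : List ℕ → List ℕ
rotate xs with initLast xs
... | []       = []
... | ys ∷ʳ′ y = y ∷ ys

rotate-∷ʳ : ∀ xs x → rotate (xs ∷ʳ x) ≡ x ∷ xs
rotate-∷ʳ xs x with xs ∷ʳ x in eq
... | ws with initLast ws
rotate-∷ʳ []      x | _ | []       with () ← eq
rotate-∷ʳ (_ ∷ _) x | _ | []       with () ← eq
rotate-∷ʳ xs      x | _ | ys ∷ʳ′ y with ∷ʳ-injective xs ys eq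
... | refl , refl = refl

extract : ℕ → List ℕ → ℕ × List ℕ
extract N []       = 0 , []
extract N (x ∷ xs) = if x ≡ᵇ N then (0 , rotate xs) else (let (k , ys) = extract N xs in suc k , x ∷ ys)

extract-insC : ∀ {N k w} → N ∉ w → k ≤ length w → extract N (insC N k w) ≡ (k , w)
extract-insC {N} {zero}  {[]}    N∉ _ rewrite ≡ᵇ-refl N = refl
extract-insC {N} {zero}  {x ∷ w} N∉ _ rewrite ≡ᵇ-refl N = cong (0 ,_) (rotate-∷ʳ w x)
extract-insC {N} {suc k} {x ∷ w} N∉ (s≤s k≤)
  rewrite ≢⇒≡ᵇ-false {x} {N} (λ eq → N∉ (here (sym eq))) | extract-insC {N} {k} {w} (N∉ ∘ there) k≤ = refl

insC-onto : ∀ {N v} → N ∈ v → ∃₂ λ k w → k ≤ length w × v ≡ insC N k w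
insC-onto {v = _ ∷ v} (here refl) with initLast v
... | []       = 0 , [] , z≤n , refl
... | ys ∷ʳ′ y = 0 , y ∷ ys , z≤n , refl
insC-onto {v = x ∷ v} (there N∈) with insC-onto N∈
... | k , w , k≤ , refl = suc k , x ∷ w , s≤s k≤ , refl

module Cyclic = Insertion insC extract insC-↭ extract-insC insC-onto

app-∷ʳ-last : ∀ xs x → app (xs ∷ʳ x) (suc (length xs)) ≡ x
app-∷ʳ-last []       x = refl
app-∷ʳ-last (y ∷ xs) x = app-∷ʳ-last xs x

app-∷ʳ-init : ∀ xs x {j} → j < length xs → app (xs ∷ʳ x) (suc j) ≡ app xs (suc j)
app-∷ʳ-init (y ∷ xs) x {zero}  _        = refl
app-∷ʳ-init (y ∷ xs) x {suc j} (s≤s j<) = app-∷ʳ-init xs x j<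

app-insC-at : ∀ N {k} w → k < length w → app (insC N k w) (suc k) ≡ N
app-insC-at N {zero}  (x ∷ xs) _        = refl
app-insC-at N {suc k} (x ∷ xs) (s≤s k<) = app-insC-at N xs k<

app-insC-max : ∀ N {k} w → k < length w → app (insC N k w) (suc (length w)) ≡ app w (suc k)
app-insC-max N {zero}  (x ∷ xs) _        = app-∷ʳ-last xs x
app-insC-max N {suc k} (x ∷ xs) (s≤s k<) = app-insC-max N xs k<

app-insC-fixed : ∀ N w → app (insC N (length w) w) (suc (length w)) ≡ N
app-insC-fixed N []       = refl
app-insC-fixed N (x ∷ xs) = app-insC-fixed N xs

app-insC-other : ∀ N {k} w {j} → j ≢ k → j < length w → app (insC N k w) (suc j) ≡ app w (suc j)
app-insC-other N {zero}  (x ∷ xs) {zero}  j≢k _        = contradiction refl j≢k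
app-insC-other N {zero}  (x ∷ xs) {suc j} j≢k (s≤s j<) = app-∷ʳ-init xs x j<
app-insC-other N {suc k} (x ∷ xs) {zero}  j≢k _        = refl
app-insC-other N {suc k} (x ∷ xs) {suc j} j≢k (s≤s j<) = app-insC-other N xs (j≢k ∘ cong suc) j<

-- Certificates for cycles: closed walks that start at their minimum

data Walk (w : List ℕ) (h : ℕ) : List ℕ → Set where
  close : ∀ {y} → app w y ≡ h → Walk w h [ y ]
  next : ∀ {y z zs} → app w y ≡ z → Walk w h (z ∷ zs) → Walk w h (y ∷ z ∷ zs)

IsCycle : List ℕ → List ℕ → Set
IsCycle w []      = ⊥
IsCycle w (h ∷ t) = Walk w h (h ∷ t) × All (h <_) t

-- A cycle decomposition with the cycles in arbitrary order. Unlike the output of `cycles`, it can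
-- be updated locally under an insertion.
record CycleForm (w : List ℕ) (cs : List (List ℕ)) : Set where
  constructor cycleForm
  field
    areCycles : All (IsCycle w) cs
    elements  : concat cs ↭ range1 (length w)
open CycleForm

concat-↭ : ∀ {A : Set} {xss yss : List (List A)} → xss ↭ yss → concat xss ↭ concat yss
concat-↭ Perm.refl         = ↭-refl
concat-↭ (Perm.prep xs p)  = ++⁺ˡ xs (concat-↭ p)
concat-↭ (Perm.swap xs ys p) = ↭-trans (shifts xs ys) (++⁺ˡ ys (++⁺ˡ xs (concat-↭ p)))
concat-↭ (Perm.trans p q)  = ↭-trans (concat-↭ p) (concat-↭ q)

CycleForm-resp-↭ : ∀ {w cs ds} → cs ↭ ds → CycleForm w cs → CycleForm w ds
CycleForm-resp-↭ p (cycleForm cyc el) = cycleForm (All-resp-↭ p cyc) (↭-trans (concat-↭ (↭-sym p)) el)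

Unique-++⁻ : ∀ {A : Set} (xs : List A) {ys} → Unique (xs ++ ys) → Unique xs × Unique ys
Unique-++⁻ []       u        = [] , u
Unique-++⁻ (x ∷ xs) (x∉ ∷ u) with Unique-++⁻ xs u
... | u₁ , u₂ = Allₚ.++⁻ˡ xs x∉ ∷ u₁ , u₂

-- Cycles as orbits

orbit : List ℕ → ℕ → ℕ → ℕ → List ℕ
orbit w i zero    _ = []
orbit w i (suc f) j = if j ≡ᵇ i then [] else j ∷ orbit w i f (app w j)

-- As for `range1`, the local search of `cycleOf` is identified with a top-level function through
-- its two equations.
orbit-unique : ∀ w i (g : ℕ → ℕ → List ℕ) → (∀ j → g 0 j ≡ []) →
  (∀ f j → g (suc f) j ≡ (if j ≡ᵇ i then [] else j ∷ g f (app w j))) → ∀ f j → g f j ≡ orbit w i f j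
orbit-unique w i g z c zero    j = z j
orbit-unique w i g z c (suc f) j = trans (c f j)
  (cong (λ t → if j ≡ᵇ i then [] else j ∷ t) (orbit-unique w i g z c f (app w j)))

mutual
  cycleOf-go : List ℕ → ℕ → ℕ → ℕ → List ℕ
  cycleOf-go = _

  cycleOf≡orbit : ∀ w i → cycleOf w i ≡ i ∷ orbit w i (length w) (app w i)
  cycleOf≡orbit w i with length w | app w i
  ... | f | j = cong (i ∷_) (orbit-unique w i (cycleOf-go w i) (λ _ → refl) (λ _ _ → refl) f j)

orbit-walk : ∀ {w h y zs} f → Walk w h (y ∷ zs) → All (h ≢_) zs → length zs ≤ f → orbit w h f (app w y) ≡ zs
orbit-walk zero    (close eq) _ _ = refl
orbit-walk {h = h} (suc f) (close eq) _ _ rewrite eq | ≡ᵇ-refl h = refl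
orbit-walk {h = h} (suc f) (next {z = z} eq walk) (h≢z ∷ ps) (s≤s le)
  rewrite eq | ≢⇒≡ᵇ-false {z} {h} (h≢z ∘ sym) = cong (z ∷_) (orbit-walk f walk ps le)

-- The rest of the walk does not revisit y, so a search from y reaches the return point h before it
-- stops. The fuel bound is strict because h comes one step after the last entry of `us`.
∈-orbit : ∀ {w h y u us} f → Walk w h (u ∷ us) → h ≢ y → All (y ≢_) us → length us < f → h ∈ orbit w y f (app w u)
∈-orbit {h = h} {y} (suc f) (close eq) h≢y _ _ rewrite eq | ≢⇒≡ᵇ-false h≢y = here refl
∈-orbit {h = h} {y} (suc f) (next {z = z} eq walk) h≢y (y≢z ∷ ps) (s≤s lt)
  rewrite eq | ≢⇒≡ᵇ-false {z} {y} (y≢z ∘ sym) = there (∈-orbit f walk h≢y ps lt)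

allB-≤⁺ : ∀ {i xs} → All (i ≤_) xs → allB (λ j → i ≤ᵇ j) xs ≡ true
allB-≤⁺ []         = refl
allB-≤⁺ (le ∷ les) rewrite ≤⇒≤ᵇ-true le = allB-≤⁺ les

allB-≤⁻ : ∀ {i} xs → T (allB (λ j → i ≤ᵇ j) xs) → All (i ≤_) xs
allB-≤⁻ []       t = []
allB-≤⁻ {i} (x ∷ xs) t with Equivalence.to T-∧ t
... | t₁ , t₂ = ℕₚ.≤ᵇ⇒≤ i x t₁ ∷ allB-≤⁻ xs t₂

cycleOf-head : ∀ {w h t} → IsCycle w (h ∷ t) → length t ≤ length w → cycleOf w h ≡ h ∷ t
cycleOf-head {w} {h} (walk , h<) le =
  trans (cycleOf≡orbit w h) (cong (h ∷_) (orbit-walk (length w) walk (All.map ℕₚ.<⇒≢ h<) le))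

module _ (w : List ℕ) where

  private
    min? = λ i → T? (isCycleMin w i)

  head-min : ∀ {h t} → IsCycle w (h ∷ t) → length t ≤ length w → T (isCycleMin w h)
  head-min {h} c@(_ , h<) le = subst (λ l → T (allB (λ j → h ≤ᵇ j) l)) (sym (cycleOf-head c le))
    (subst T (sym (allB-≤⁺ (ℕₚ.≤-refl ∷ All.map ℕₚ.<⇒≤ h<))) tt)

  tail-not-min : ∀ {h y us} → Walk w h (y ∷ us) → h < y → All (y ≢_) us → length us < length w → ¬ T (isCycleMin w y)
  tail-not-min {h} {y} walk h<y y∉ lt t =
    ℕₚ.<⇒≱ h<y (All.lookup (allB-≤⁻ _ (subst (λ l → T (allB (λ j → y ≤ᵇ j) l)) (cycleOf≡orbit w y) t))
      (there (∈-orbit (length w) walk (ℕₚ.<⇒≢ h<y) y∉ lt)))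

  filter-tail : ∀ {h us} → Walk w h us → All (h <_) us → Unique us → length us ≤ length w → filter min? us ≡ []
  filter-tail walk@(close _)    (h<y ∷ _)  (y∉ ∷ _) le =
    filter-reject min? (tail-not-min walk h<y y∉ le)
  filter-tail walk@(next _ wk) (h<y ∷ h<) (y∉ ∷ u) le =
    trans (filter-reject min? (tail-not-min walk h<y y∉ le)) (filter-tail wk h< u (ℕₚ.<⇒≤ le))

  filter-cycle : ∀ c → IsCycle w c → Unique c → length c ≤ length w → map (cycleOf w) (filter min? c) ≡ [ c ]
  filter-cycle (h ∷ t) c@(walk , h<) (_ ∷ u) le =
    trans (cong (map (cycleOf w)) (trans (filter-accept min? (head-min c le′)) (cong (h ∷_) (tail walk h< u le))))
      (cong [_] (cycleOf-head c le′))
    where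
    le′ = ℕₚ.<⇒≤ le
    tail : ∀ {t} → Walk w h (h ∷ t) → All (h <_) t → Unique t → suc (length t) ≤ length w → filter min? t ≡ []
    tail (close _)    _  _ _  = refl
    tail (next _ wk) h< u le = filter-tail wk h< u (ℕₚ.<⇒≤ le)

  filter-cycles : ∀ cs → All (IsCycle w) cs → Unique (concat cs) → length (concat cs) ≤ length w →
    map (cycleOf w) (filter min? (concat cs)) ≡ cs
  filter-cycles []       _         _ _  = refl
  filter-cycles (c ∷ cs) (cyc ∷ cycs) u le rewrite filter-++ min? c (concat cs)
    | map-++ (cycleOf w) (filter min? c) (filter min? (concat cs)) | length-++ c {concat cs} =
    cong₂ _++_ (filter-cycle c cyc (proj₁ (Unique-++⁻ c u)) (ℕₚ.m+n≤o⇒m≤o (length c) le))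
      (filter-cycles cs cycs (proj₂ (Unique-++⁻ c u)) (ℕₚ.m+n≤o⇒n≤o (length c) le))

  CycleForm-unique : ∀ {cs} → CycleForm w cs → Unique (concat cs)
  CycleForm-unique cf = Unique-resp-↭ (↭-sym (elements cf)) (range1-unique (length w))

  -- Instead of filtering [1 ... n], filter the concatenation of the certified cycles: each keeps
  -- only its head, which is its minimum, and `cycleOf` at the head rebuilds the cycle.
  cycles-↭ : ∀ {cs} → CycleForm w cs → cycles w ↭ cs
  cycles-↭ {cs} cf = ↭-trans (Permₚ.map⁺ (cycleOf w) (filter-↭ min? (↭-sym (elements cf))))
    (↭-reflexive (filter-cycles cs (areCycles cf) (CycleForm-unique cf)
      (ℕₚ.≤-reflexive (trans (↭-length (elements cf)) (length-range1 (length w))))))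

-- Effect of an insertion on the cycles

module _ (w : List ℕ) where

  private
    N = suc (length w)

  -- The points at which the enlarged permutation agrees with the old one.
  Old : ℕ → ℕ → Set
  Old k y = ∃ λ j → y ≡ suc j × j < length w × j ≢ k

  app-old : ∀ {k y} → Old k y → app (insC N k w) y ≡ app w y
  app-old (j , refl , j< , j≢k) = app-insC-other N w j≢k j<

  walk-old : ∀ {k h c} → All (Old k) c → Walk w h c → Walk (insC N k w) h c
  walk-old (o ∷ _)  (close eq)      = close (trans (app-old o) eq)
  walk-old (o ∷ os) (next eq walk) = next (trans (app-old o) eq) (walk-old os walk)

  -- Only the edge leaving `suc k` changes: it is subdivided by N. If that edge closes the walk, N
  -- becomes the last entry.
  walk-insert : ∀ {k h} as {bs} → k < length w → All (Old k) as → All (Old k) bs →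
    Walk w h (as ++ suc k ∷ bs) → Walk (insC N k w) h (as ++ suc k ∷ N ∷ bs)
  walk-insert []           k< _        _  (close eq)      =
    next (app-insC-at N w k<) (close (trans (app-insC-max N w k<) eq))
  walk-insert []           k< _        os (next eq walk) =
    next (app-insC-at N w k<) (next (trans (app-insC-max N w k<) eq) (walk-old os walk))
  walk-insert (a ∷ [])     k< (o ∷ _)  os (next eq walk) =
    next (trans (app-old o) eq) (walk-insert [] k< [] os walk)
  walk-insert (a ∷ b ∷ as) k< (o ∷ ps) os (next eq walk) =
    next (trans (app-old o) eq) (walk-insert (b ∷ as) k< ps os walk)

  -- N exceeds all other entries and stands behind one of them, so the head remains the minimum and
  -- the normal form survives.
  cycle-insert : ∀ {k} as {bs} → k < length w → All (Old k) as → All (Old k) bs →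
    IsCycle w (as ++ suc k ∷ bs) → IsCycle (insC N k w) (as ++ suc k ∷ N ∷ bs)
  cycle-insert []       k< os ps (walk , h<) = walk-insert [] k< os ps walk , s≤s k< ∷ h<
  cycle-insert (h ∷ as) k< os ps (walk , h<) with Allₚ.++⁻ as h<
  ... | h<as , h<k ∷ h<bs = walk-insert (h ∷ as) k< os ps walk ,
    Allₚ.++⁺ h<as (h<k ∷ ℕₚ.<-trans h<k (s≤s k<) ∷ h<bs)

  cycles-old : ∀ {k} cs → All (Old k) (concat cs) → All (IsCycle w) cs → All (IsCycle (insC N k w)) cs
  cycles-old []             os []                  = []
  cycles-old ((h ∷ t) ∷ cs) os ((walk , h<) ∷ cyc) with Allₚ.++⁻ (h ∷ t) os
  ... | os₁ , os₂ = (walk-old os₁ walk , h<) ∷ cycles-old cs os₂ cyc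

  insC-elements : ∀ {k xs ys} → xs ↭ N ∷ ys → ys ↭ range1 (length w) → xs ↭ range1 (length (insC N k w))
  insC-elements {k} p q rewrite ↭-length (insC-↭ N k w) = ↭-trans p (↭-trans (↭-prep N q) (range1-suc-↭ (length w)))

  CycleForm-fixed : ∀ {cs} → CycleForm w cs → CycleForm (insC N (length w) w) ([ N ] ∷ cs)
  CycleForm-fixed {cs} (cycleForm cyc el) = cycleForm
    ((close (app-insC-fixed N w) , []) ∷ cycles-old cs (All.tabulate old) cyc)
    (insC-elements {length w} ↭-refl el)
    where
    old : ∀ {y} → y ∈ concat cs → Old (length w) y
    old y∈ with ∈-range1⁻ (∈-resp-↭ el y∈)
    ... | j , eq , j< = j , eq , j< , ℕₚ.<⇒≢ j<

  CycleForm-insert : ∀ {k} as {bs cs} → CycleForm w ((as ++ suc k ∷ bs) ∷ cs) →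
    CycleForm (insC N k w) ((as ++ suc k ∷ N ∷ bs) ∷ cs)
  CycleForm-insert {k} as {bs} {cs} cf@(cycleForm (c ∷ cyc) el)
    with Allₚ.++⁻ as (All.tabulate {P = Old k} old)
    where
    moved : as ++ suc k ∷ bs ++ concat cs ↭ suc k ∷ as ++ bs ++ concat cs
    moved = shift (suc k) as (bs ++ concat cs)
    el′ : suc k ∷ as ++ bs ++ concat cs ↭ range1 (length w)
    el′ = ↭-trans (↭-sym moved) (↭-trans (↭-reflexive (sym (++-assoc as (suc k ∷ bs) (concat cs)))) el)
    old : ∀ {y} → y ∈ as ++ bs ++ concat cs → Old k y
    old y∈ with ∈-range1⁻ (∈-resp-↭ el′ (there y∈)) | Unique-resp-↭ (↭-sym el′) (range1-unique (length w))
    ... | j , refl , j< | k∉ ∷ _ = j , refl , j< , λ { refl → All.lookup k∉ y∈ refl }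
  ... | os , os′ with Allₚ.++⁻ bs os′
  ... | os₁ , os₂ = cycleForm (cycle-insert as k< os os₁ c ∷ cycles-old cs os₂ cyc)
    (insC-elements {k} (++⁺ʳ (concat cs) moveN) el)
    where
    k< : k < length w
    k< with ∈-range1⁻ (∈-resp-↭ el (∈-++⁺ˡ (∈-insert as)))
    ... | _ , refl , k<n = k<n
    moveN : as ++ suc k ∷ N ∷ bs ↭ N ∷ as ++ suc k ∷ bs
    moveN = ↭-trans (++⁺ˡ as (↭-swap (suc k) N ↭-refl)) (shift N as (suc k ∷ bs))

CycleForm-perm : ∀ n {w} → w ∈ perms n → ∃ (CycleForm w)
CycleForm-perm zero    (here refl) = [] , cycleForm [] ↭-refl
CycleForm-perm (suc n) v∈ with Cyclic.perms-suc⁻ {n} v∈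
... | k , w , k≤n , w∈ , refl with CycleForm-perm n w∈ | length-perm {n} w∈
... | cs , cf | refl with ℕₚ.m≤n⇒m<n∨m≡n k≤n
... | inj₂ refl = _ , CycleForm-fixed w cf
... | inj₁ k<n with ∈-concat⁻′ cs (∈-resp-↭ (↭-sym (elements cf)) (∈-range1⁺ k<n))
... | c , k∈c , c∈cs with ∈-∃++ c∈cs | ∈-∃++ k∈c
... | pre , post , refl | as , bs , refl =
  _ , CycleForm-insert w as (CycleForm-resp-↭ (shift c pre post) cf)

CycleForm-cycles : ∀ n {w} → w ∈ perms n → CycleForm w (cycles w)
CycleForm-cycles n {w} w∈ with CycleForm-perm n w∈
... | cs , cf = CycleForm-resp-↭ (↭-sym (cycles-↭ w cf)) cf

-- Cyclic ascents and descents

-- cyc x y is the type of a cycle with x + 1 cyclic ascents and y + 1 cyclic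
-- descents; a fixed point has one cyclic ascent and no cyclic descent.
data CycleType : Set where
  fix : CycleType
  cyc : ℕ → ℕ → CycleType

-- Among pairs of counts that satisfy `Valid`, only (1, 0) falls into the default clause.
encode : ℕ → ℕ → CycleType
encode (suc x) (suc y) = cyc x y
encode _       _       = fix

type : List ℕ → CycleType
type c = encode (cA c) (cD c)

data Valid : ℕ → ℕ → Set where
  one  : Valid 1 0
  more : ∀ {x y} → Valid (suc x) (suc y)

#_ : Bool → ℕ
# x = if x then 1 else 0

ups downs : ℕ → List ℕ → ℕ
ups h []             = 0
ups h (x ∷ [])       = # (x ≤ᵇ h)
ups h (x ∷ y ∷ zs)   = # (x ≤ᵇ y) ℕ.+ ups h (y ∷ zs)
downs h []           = 0
downs h (x ∷ [])     = # (h <ᵇ x)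
downs h (x ∷ y ∷ zs) = # (y <ᵇ x) ℕ.+ downs h (y ∷ zs)

-- `P` stands for the anonymous pattern-matching function inside `cA`, which is accessible only
-- through its pointwise values.
countB-ups : ∀ P → (∀ x y → P (x , y) ≡ (x ≤ᵇ y)) → ∀ h x xs →
  countB P (cyclicPairsFrom h (x ∷ xs)) ≡ ups h (x ∷ xs)
countB-ups P eq h x []       rewrite eq x h = ℕₚ.+-identityʳ _
countB-ups P eq h x (y ∷ zs) rewrite eq x y = cong (# (x ≤ᵇ y) ℕ.+_) (countB-ups P eq h y zs)

countB-downs : ∀ P → (∀ x y → P (x , y) ≡ (y <ᵇ x)) → ∀ h x xs →
  countB P (cyclicPairsFrom h (x ∷ xs)) ≡ downs h (x ∷ xs)
countB-downs P eq h x []       rewrite eq x h = ℕₚ.+-identityʳ _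
countB-downs P eq h x (y ∷ zs) rewrite eq x y = cong (# (y <ᵇ x) ℕ.+_) (countB-downs P eq h y zs)

cA≡ups : ∀ h t → cA (h ∷ t) ≡ ups h (h ∷ t)
cA≡ups h t = countB-ups _ (λ _ _ → refl) h h t

cD≡downs : ∀ h t → cD (h ∷ t) ≡ downs h (h ∷ t)
cD≡downs h t = countB-downs _ (λ _ _ → refl) h h t

>⇒≤ᵇ-false : ∀ {m n} → n < m → (m ≤ᵇ n) ≡ false
>⇒≤ᵇ-false {suc m} (s≤s n≤m) = ≥⇒<ᵇ-false n≤m

data Compare (x y : ℕ) : Set where
  up   : (x ≤ᵇ y) ≡ true  → (y <ᵇ x) ≡ false → Compare x y
  down : (x ≤ᵇ y) ≡ false → (y <ᵇ x) ≡ true  → Compare x y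

compare : ∀ x y → Compare x y
compare x y with ℕₚ.≤-<-connex x y
... | inj₁ x≤y = up (≤⇒≤ᵇ-true x≤y) (≥⇒<ᵇ-false x≤y)
... | inj₂ y<x = down (>⇒≤ᵇ-false y<x) (<⇒<ᵇ-true y<x)

ups+downs : ∀ h x xs → ups h (x ∷ xs) ℕ.+ downs h (x ∷ xs) ≡ suc (length xs)
ups+downs h x [] with compare x h
... | up p q   rewrite p | q = refl
... | down p q rewrite p | q = refl
ups+downs h x (y ∷ zs) with compare x y
... | up p q   rewrite p | q = cong suc (ups+downs h y zs)
... | down p q rewrite p | q = trans (ℕₚ.+-suc _ _) (cong suc (ups+downs h y zs))

-- A cycle with at least two entries leaves its minimum by an ascent and returns to it by a descent.
cycle-valid : ∀ {w} c → IsCycle w c → Valid (cA c) (cD c)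
cycle-valid (h ∷ []) _ rewrite cA≡ups h [] | cD≡downs h []
  | ≤⇒≤ᵇ-true (ℕₚ.≤-refl {h}) | ≥⇒<ᵇ-false (ℕₚ.≤-refl {h}) = one
cycle-valid (h ∷ z ∷ zs) (_ , h<z ∷ h<) rewrite cA≡ups h (z ∷ zs) | cD≡downs h (z ∷ zs)
  | ≤⇒≤ᵇ-true (ℕₚ.<⇒≤ h<z) | ≥⇒<ᵇ-false (ℕₚ.<⇒≤ h<z) = valid (last-down z zs (h<z ∷ h<))
  where
  last-down : ∀ z zs → All (h <_) (z ∷ zs) → 0 < downs h (z ∷ zs)
  last-down z []       (h<z ∷ []) rewrite <⇒<ᵇ-true h<z = s≤s z≤n
  last-down z (y ∷ ys) (_ ∷ h<)   = ℕₚ.<-≤-trans (last-down y ys h<) (ℕₚ.m≤n+m _ _)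
  valid : ∀ {x y} → 0 < y → Valid (suc x) y
  valid (s≤s _) = more

-- 𝒟 g sums g over all insertions of a new maximum into a cycle of a given type:
-- a cyclic ascent becomes an ascent and a descent, and so does a cyclic descent.
𝒟 : (CycleType → ℤ) → CycleType → ℤ
𝒟 g fix       = g (cyc 0 0)
𝒟 g (cyc x y) = + suc x * g (cyc x (suc y)) + + suc y * g (cyc (suc x) y)

-- There is no insertion before the head: cyclically that is the insertion behind the last entry,
-- and the minimum has to stay in front.
insA : ℕ → List ℕ → List (List ℕ)
insA N []       = []
insA N (x ∷ xs) = (x ∷ N ∷ xs) ∷ map (x ∷_) (insA N xs)

insA-head : ∀ {N y ys c} → c ∈ insA N (y ∷ ys) → ∃ λ t → c ≡ y ∷ t
insA-head (here refl) = _ , refl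
insA-head {y = y} (there c∈) with ∈-map⁻ (y ∷_) c∈
... | t , _ , eq = t , eq

insA-counts-∷ : ∀ N h x y zs (G : ℕ → ℕ → ℤ) {c} → c ∈ insA N (y ∷ zs) →
  G (ups h (x ∷ c)) (downs h (x ∷ c)) ≡ G (# (x ≤ᵇ y) ℕ.+ ups h c) (# (y <ᵇ x) ℕ.+ downs h c)
insA-counts-∷ N h x y zs G c∈ with insA-head {N} {y} {zs} c∈
... | t , refl = refl

-- `G` is arbitrary so that the induction can absorb the contribution of the first step into it. The
-- hypothesis `h < N` makes the closing step a descent when N is put last.
∑-insA-counts : ∀ N h x xs (G : ℕ → ℕ → ℤ) → h < N → All (_< N) (x ∷ xs) →
  ∑ (insA N (x ∷ xs)) (λ c → G (ups h c) (downs h c))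
    ≡ + ups h (x ∷ xs) * G (ups h (x ∷ xs)) (suc (downs h (x ∷ xs)))
      + + downs h (x ∷ xs) * G (suc (ups h (x ∷ xs))) (downs h (x ∷ xs))
∑-insA-counts N h x [] G h<N (x<N ∷ [])
  rewrite ≤⇒≤ᵇ-true (ℕₚ.<⇒≤ x<N) | ≥⇒<ᵇ-false (ℕₚ.<⇒≤ x<N) | <⇒<ᵇ-true h<N | >⇒≤ᵇ-false h<N
  with compare x h
... | up p q rewrite p | q = lemma (G 1 1) (G 2 0)
  where
  lemma : ∀ u v → u + + 0 ≡ + 1 * u + + 0 * v
  lemma = solve-∀
... | down p q rewrite p | q = lemma (G 0 2) (G 1 1)
  where
  lemma : ∀ u v → v + + 0 ≡ + 0 * u + + 1 * v
  lemma = solve-∀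
∑-insA-counts N h x (y ∷ zs) G h<N (x<N ∷ y<N ∷ zs<N)
  rewrite ≤⇒≤ᵇ-true (ℕₚ.<⇒≤ x<N) | ≥⇒<ᵇ-false (ℕₚ.<⇒≤ x<N) | <⇒<ᵇ-true y<N | >⇒≤ᵇ-false y<N
        | ∑-map (λ c → G (ups h c) (downs h c)) (x ∷_) (insA N (y ∷ zs))
        | ∑-cong (insA N (y ∷ zs)) (insA-counts-∷ N h x y zs G)
        | ∑-insA-counts N h y zs (λ a e → G (# (x ≤ᵇ y) ℕ.+ a) (# (y <ᵇ x) ℕ.+ e)) h<N (y<N ∷ zs<N)
  with compare x y
... | up p q rewrite p | q = lemma (G (suc (ups h (y ∷ zs))) (suc (downs h (y ∷ zs)))) (G (suc (suc (ups h (y ∷ zs)))) (downs h (y ∷ zs))) (+ ups h (y ∷ zs)) (+ downs h (y ∷ zs))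
  where
  lemma : ∀ u v a e → u + (a * u + e * v) ≡ (+ 1 + a) * u + e * v
  lemma = solve-∀
... | down p q rewrite p | q = lemma (G (ups h (y ∷ zs)) (suc (suc (downs h (y ∷ zs))))) (G (suc (ups h (y ∷ zs))) (suc (downs h (y ∷ zs)))) (+ ups h (y ∷ zs)) (+ downs h (y ∷ zs))
  where
  lemma : ∀ u v a e → v + (a * u + e * v) ≡ a * u + (+ 1 + e) * v
  lemma = solve-∀

∑-insA : ∀ {w} N c (g : CycleType → ℤ) → IsCycle w c → All (_< N) c → ∑ (insA N c) (g ∘ type) ≡ 𝒟 g (type c)
∑-insA N c@(h ∷ t) g isc all@(h<N ∷ _) = trans (∑-cong (insA N c) counts)
  (trans (∑-insA-counts N h h t (λ a e → g (encode a e)) h<N all) (trans (cong₂ formula (sym (cA≡ups h t)) (sym (cD≡downs h t))) (decode (cycle-valid c isc))))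
  where
  formula : ℕ → ℕ → ℤ
  formula a e = + a * g (encode a (suc e)) + + e * g (encode (suc a) e)
  counts : ∀ {c′} → c′ ∈ insA N c → g (type c′) ≡ g (encode (ups h c′) (downs h c′))
  counts c′∈ with insA-head {N} {h} {t} c′∈
  ... | t′ , refl = cong₂ (λ a e → g (encode a e)) (cA≡ups h t′) (cD≡downs h t′)
  decode : ∀ {a e} → Valid a e → formula a e ≡ 𝒟 g (encode a e)
  -- The meaningless value `encode 2 0` has coefficient 0, since a fixed point has no cyclic descent
  -- to split.
  decode one  = trans (+-identityʳ _) (ℤₚ.*-identityˡ _)
  decode more = refl

-- Sums over all permutations of functions of the cycle types

types : List ℕ → List CycleType
types w = map type (cycles w)

Δc : (List CycleType → ℤ) → List CycleType → ℤ
Δc F []       = + 0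
Δc F (t ∷ ts) = 𝒟 (λ t′ → F (t′ ∷ ts)) t + Δc (λ ts′ → F (t ∷ ts′)) ts

𝒟-cong : ∀ {f g} → (∀ t → f t ≡ g t) → ∀ t → 𝒟 f t ≡ 𝒟 g t
𝒟-cong eq fix       = eq _
𝒟-cong eq (cyc x y) = cong₂ (λ u v → + suc x * u + + suc y * v) (eq _) (eq _)

Δc-cong : ∀ {F G} → (∀ ts → F ts ≡ G ts) → ∀ ts → Δc F ts ≡ Δc G ts
Δc-cong eq []       = refl
Δc-cong eq (t ∷ ts) = cong₂ _+_ (𝒟-cong (λ t′ → eq (t′ ∷ ts)) t) (Δc-cong (λ ts′ → eq (t ∷ ts′)) ts)

-- `types` follows the order of `cycles`, which certificates built by insertion do not respect.
Symmetric : (List CycleType → ℤ) → Set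
Symmetric F = ∀ {ts us} → ts ↭ us → F ts ≡ F us

∑-insA-elements : ∀ N (H : ℕ → ℤ) (K : List ℕ → ℤ) as bs →
  (∀ xs i ys → as ++ bs ≡ xs ++ i ∷ ys → H i ≡ K (xs ++ i ∷ N ∷ ys)) → ∑ bs H ≡ ∑ (insA N bs) (λ c → K (as ++ c))
∑-insA-elements N H K as []       eq = refl
∑-insA-elements N H K as (x ∷ bs) eq = cong₂ _+_ (eq as x bs refl)
  (trans (∑-insA-elements N H K (as ∷ʳ x) bs (λ xs i ys e → eq xs i ys (trans (sym (++-assoc as [ x ] bs)) e)))
    (trans (∑-cong (insA N bs) (λ {c} _ → cong K (++-assoc as [ x ] c)))
      (sym (∑-map (λ c → K (as ++ c)) (x ∷_) (insA N bs)))))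

module _ (w : List ℕ) (F : List CycleType → ℤ) (F-sym : Symmetric F) where

  private
    N = suc (length w)

  F-types : ∀ {v} cs {ts} → CycleForm v cs → map type cs ↭ ts → F (types v) ≡ F ts
  F-types {v} cs cf p = F-sym (↭-trans (Permₚ.map⁺ type (cycles-↭ v cf)) p)

  -- `pre` collects the cycles already treated. The cycle receiving N is moved to the front for
  -- `CycleForm-insert`, and symmetry of F moves its type back.
  ∑-insC-cycles : ∀ pre cs → CycleForm w (pre ++ cs) →
    ∑ (concat cs) (λ i → F (types (insC N (ℕ.pred i) w))) ≡ Δc (λ ts → F (map type pre ++ ts)) (map type cs)
  ∑-insC-cycles pre []       cf = refl
  ∑-insC-cycles pre (c ∷ cs) cf = trans (∑-++ _ c (concat cs)) (cong₂ _+_ this rest)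
    where
    cf′ : CycleForm w (c ∷ pre ++ cs)
    cf′ = CycleForm-resp-↭ (shift c pre cs) cf
    member : ∀ {i} → i ∈ c → ∃ λ k → i ≡ suc k × k < length w
    member i∈ = ∈-range1⁻ (∈-resp-↭ (elements cf′) (∈-++⁺ˡ i∈))
    below : ∀ {i} → (∃ λ k → i ≡ suc k × k < length w) → i < N
    below (k , refl , k<) = s≤s k<
    each : ∀ xs i ys → c ≡ xs ++ i ∷ ys →
      F (types (insC N (ℕ.pred i) w)) ≡ F (map type pre ++ type (xs ++ i ∷ N ∷ ys) ∷ map type cs)
    each xs i ys refl with member (∈-insert xs)
    ... | k , refl , _ = F-types _ (CycleForm-insert w xs cf′)
      (↭-trans (↭-prep _ (↭-reflexive (map-++ type pre cs))) (↭-sym (shift _ (map type pre) (map type cs))))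
    this : ∑ c (λ i → F (types (insC N (ℕ.pred i) w))) ≡ 𝒟 (λ t → F (map type pre ++ t ∷ map type cs)) (type c)
    this = trans (∑-insA-elements N _ (λ c′ → F (map type pre ++ type c′ ∷ map type cs)) [] c each)
      (∑-insA N c _ (All.head (areCycles cf′)) (All.tabulate (below ∘ member)))
    rest : ∑ (concat cs) (λ i → F (types (insC N (ℕ.pred i) w)))
      ≡ Δc (λ ts → F (map type pre ++ type c ∷ ts)) (map type cs)
    rest = trans (∑-insC-cycles (pre ∷ʳ c) cs (subst (CycleForm w) (sym (++-assoc pre [ c ] cs)) cf))
      (Δc-cong (λ ts → cong F (trans (cong (_++ ts) (map-++ type pre [ c ])) (++-assoc (map type pre) [ type c ] ts)))
        (map type cs))

  ∑-insC : ∀ {cs} → CycleForm w cs →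
    ∑ (upTo N) (λ k → F (types (insC N k w))) ≡ F (fix ∷ map type cs) + Δc F (map type cs)
  ∑-insC {cs} cf = begin
    ∑ (upTo N) H                           ≡⟨ cong (λ l → ∑ l H) (sym (upTo-∷ʳ (length w))) ⟩
    ∑ (upTo (length w) ∷ʳ length w) H      ≡⟨ ∑-↭ H (↭-sym (∷↭∷ʳ (length w) (upTo (length w)))) ⟩
    H (length w) + ∑ (upTo (length w)) H   ≡⟨ cong₂ _+_ fixed others ⟩
    F (fix ∷ map type cs) + Δc F (map type cs) ∎
    where
    open ≡-Reasoning
    H : ℕ → ℤ
    H k = F (types (insC N k w))
    type-singleton : type [ N ] ≡ fix
    type-singleton rewrite cA≡ups N [] | cD≡downs N [] | ≤⇒≤ᵇ-true (ℕₚ.≤-refl {N}) | ≥⇒<ᵇ-false (ℕₚ.≤-refl {N}) = refl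
    fixed : H (length w) ≡ F (fix ∷ map type cs)
    fixed = F-types _ (CycleForm-fixed w cf) (↭-reflexive (cong (_∷ map type cs) type-singleton))
    others : ∑ (upTo (length w)) H ≡ Δc F (map type cs)
    others = trans (sym (∑-map (H ∘ ℕ.pred) suc (upTo (length w))))
      (trans (cong (λ l → ∑ l (H ∘ ℕ.pred)) (sym (range1≡map-upTo (length w))))
        (trans (∑-↭ (H ∘ ℕ.pred) (↭-sym (elements cf))) (∑-insC-cycles [] cs cf)))

X : ℕ → (List CycleType → ℤ) → ℤ
X n F = ∑ (perms n) (F ∘ types)

X-suc : ∀ n F → Symmetric F → X (suc n) F ≡ X n (λ ts → F (fix ∷ ts) + Δc F ts)
X-suc n F F-sym = trans (Cyclic.∑-perms-suc n (F ∘ types)) (∑-cong (perms n) each)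
  where
  each : ∀ {w} → w ∈ perms n → ∑ (upTo (suc n)) (λ k → F (types (insC (suc n) k w))) ≡ F (fix ∷ types w) + Δc F (types w)
  each {w} w∈ with refl ← length-perm {n} w∈ = ∑-insC w F F-sym (CycleForm-cycles n w∈)

-- Functions of the cycle types supported on few cycles

g₀ : CycleType → ℤ
g₀ fix       = + 1
g₀ (cyc _ _) = + 0

-- e₁ g and e₂ g h vanish unless all cycles but one, respectively two, are fixed points.
e₀ : List CycleType → ℤ
e₀ []       = + 1
e₀ (t ∷ ts) = g₀ t * e₀ ts

e₁ : (CycleType → ℤ) → List CycleType → ℤ
e₁ g []       = + 0
e₁ g (t ∷ ts) = g t * e₀ ts + g₀ t * e₁ g ts

e₂ : (g h : CycleType → ℤ) → List CycleType → ℤ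
e₂ g h []       = + 0
e₂ g h (t ∷ ts) = g t * e₁ h ts + h t * e₁ g ts + g₀ t * e₂ g h ts

e₀-sym : Symmetric e₀
e₀-sym Perm.refl         = refl
e₀-sym (Perm.prep t p)   = cong (_*_ (g₀ t)) (e₀-sym p)
e₀-sym (Perm.swap {ys = us} t u p) rewrite e₀-sym p = lemma (g₀ t) (g₀ u) (e₀ us)
  where
  lemma : ∀ a b c → a * (b * c) ≡ b * (a * c)
  lemma = solve-∀
e₀-sym (Perm.trans p q)  = trans (e₀-sym p) (e₀-sym q)

e₁-sym : ∀ g → Symmetric (e₁ g)
e₁-sym g Perm.refl       = refl
e₁-sym g (Perm.prep t p) = cong₂ (λ a b → g t * a + g₀ t * b) (e₀-sym p) (e₁-sym g p)
e₁-sym g (Perm.swap {ys = us} t u p) rewrite e₀-sym p | e₁-sym g p = lemma (g t) (g u) (g₀ t) (g₀ u) (e₀ us) (e₁ g us)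
  where
  lemma : ∀ a b a₀ b₀ c d → a * (b₀ * c) + a₀ * (b * c + b₀ * d) ≡ b * (a₀ * c) + b₀ * (a * c + a₀ * d)
  lemma = solve-∀
e₁-sym g (Perm.trans p q) = trans (e₁-sym g p) (e₁-sym g q)

e₂-sym : ∀ g h → Symmetric (e₂ g h)
e₂-sym g h Perm.refl       = refl
e₂-sym g h (Perm.prep t p) rewrite e₁-sym g p | e₁-sym h p | e₂-sym g h p = refl
e₂-sym g h (Perm.swap {ys = us} t u p) rewrite e₀-sym p | e₁-sym g p | e₁-sym h p | e₂-sym g h p =
  lemma (g t) (g u) (h t) (h u) (g₀ t) (g₀ u) (e₀ us) (e₁ g us) (e₁ h us) (e₂ g h us)
  where
  lemma : ∀ a b x y a₀ b₀ c g h d →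
    a * (y * c + b₀ * h) + x * (b * c + b₀ * g) + a₀ * (b * h + y * g + b₀ * d)
      ≡ b * (x * c + a₀ * h) + y * (a * c + a₀ * g) + b₀ * (a * h + x * g + a₀ * d)
  lemma = solve-∀
e₂-sym g h (Perm.trans p q) = trans (e₂-sym g h p) (e₂-sym g h q)

𝒟-+ : ∀ f g t → 𝒟 (λ u → f u + g u) t ≡ 𝒟 f t + 𝒟 g t
𝒟-+ f g fix       = refl
𝒟-+ f g (cyc x y) = lemma (+ suc x) (+ suc y) (f (cyc x (suc y))) (g (cyc x (suc y))) (f (cyc (suc x) y)) (g (cyc (suc x) y))
  where
  lemma : ∀ x y a b c d → x * (a + b) + y * (c + d) ≡ (x * a + y * c) + (x * b + y * d)
  lemma = solve-∀

𝒟-*ʳ : ∀ f k t → 𝒟 (λ u → f u * k) t ≡ 𝒟 f t * k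
𝒟-*ʳ f k fix       = refl
𝒟-*ʳ f k (cyc x y) = lemma (+ suc x) (+ suc y) (f (cyc x (suc y))) (f (cyc (suc x) y)) k
  where
  lemma : ∀ x y a c k → x * (a * k) + y * (c * k) ≡ (x * a + y * c) * k
  lemma = solve-∀

-- Inserting into an existing cycle never produces a fixed point; a new one arises only as a cycle
-- of its own.
𝒟-g₀ : ∀ t → 𝒟 g₀ t ≡ + 0
𝒟-g₀ fix       = refl
𝒟-g₀ (cyc x y) = lemma (+ suc x) (+ suc y)
  where
  lemma : ∀ x y → x * + 0 + y * + 0 ≡ + 0
  lemma = solve-∀

Δc-+ : ∀ F G ts → Δc (λ us → F us + G us) ts ≡ Δc F ts + Δc G ts
Δc-+ F G []       = refl
Δc-+ F G (t ∷ ts) rewrite 𝒟-+ (λ u → F (u ∷ ts)) (λ u → G (u ∷ ts)) t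
  | Δc-+ (λ us → F (t ∷ us)) (λ us → G (t ∷ us)) ts =
  lemma (𝒟 (λ u → F (u ∷ ts)) t) (𝒟 (λ u → G (u ∷ ts)) t) (Δc (λ us → F (t ∷ us)) ts) (Δc (λ us → G (t ∷ us)) ts)
  where
  lemma : ∀ a b c d → (a + b) + (c + d) ≡ (a + c) + (b + d)
  lemma = solve-∀

Δc-* : ∀ k F ts → Δc (λ us → k * F us) ts ≡ k * Δc F ts
Δc-* k F []       = sym (ℤₚ.*-zeroʳ k)
Δc-* k F (t ∷ ts) = trans
  (cong₂ _+_ (trans (𝒟-cong (λ u → ℤₚ.*-comm k (F (u ∷ ts))) t) (trans (𝒟-*ʳ (λ u → F (u ∷ ts)) k t) (ℤₚ.*-comm (𝒟 (λ u → F (u ∷ ts)) t) k)))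
    (Δc-* k (λ us → F (t ∷ us)) ts))
  (sym (ℤₚ.*-distribˡ-+ k (𝒟 (λ u → F (u ∷ ts)) t) (Δc (λ us → F (t ∷ us)) ts)))

Δc-e₀ : ∀ ts → Δc e₀ ts ≡ + 0
Δc-e₀ []       = refl
Δc-e₀ (t ∷ ts) rewrite 𝒟-*ʳ g₀ (e₀ ts) t | 𝒟-g₀ t | Δc-* (g₀ t) e₀ ts | Δc-e₀ ts = lemma (g₀ t) (e₀ ts)
  where
  lemma : ∀ a c → + 0 * c + a * + 0 ≡ + 0
  lemma = solve-∀

Δc-e₁ : ∀ g ts → Δc (e₁ g) ts ≡ e₁ (𝒟 g) ts
Δc-e₁ g []       = refl
Δc-e₁ g (t ∷ ts)
  rewrite 𝒟-+ (λ u → g u * e₀ ts) (λ u → g₀ u * e₁ g ts) t | 𝒟-*ʳ g (e₀ ts) t | 𝒟-*ʳ g₀ (e₁ g ts) t | 𝒟-g₀ t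
        | Δc-+ (λ us → g t * e₀ us) (λ us → g₀ t * e₁ g us) ts | Δc-* (g t) e₀ ts | Δc-* (g₀ t) (e₁ g) ts
        | Δc-e₀ ts | Δc-e₁ g ts = lemma (g t) (g₀ t) (𝒟 g t) (e₀ ts) (e₁ g ts) (e₁ (𝒟 g) ts)
  where
  lemma : ∀ a a₀ δ c d δ′ → (δ * c + + 0 * d) + (a * + 0 + a₀ * δ′) ≡ δ * c + a₀ * δ′
  lemma = solve-∀

-- Leibniz rule: insertion acts on one cycle at a time, and when it hits one of the cycles weighted
-- by `g₀` the term vanishes.
Δc-e₂ : ∀ g h ts → Δc (e₂ g h) ts ≡ e₂ (𝒟 g) h ts + e₂ g (𝒟 h) ts
Δc-e₂ g h []       = refl
Δc-e₂ g h (t ∷ ts)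
  rewrite 𝒟-+ (λ u → g u * e₁ h ts + h u * e₁ g ts) (λ u → g₀ u * e₂ g h ts) t
        | 𝒟-+ (λ u → g u * e₁ h ts) (λ u → h u * e₁ g ts) t
        | 𝒟-*ʳ g (e₁ h ts) t | 𝒟-*ʳ h (e₁ g ts) t | 𝒟-*ʳ g₀ (e₂ g h ts) t | 𝒟-g₀ t
        | Δc-+ (λ us → g t * e₁ h us + h t * e₁ g us) (λ us → g₀ t * e₂ g h us) ts
        | Δc-+ (λ us → g t * e₁ h us) (λ us → h t * e₁ g us) ts
        | Δc-* (g t) (e₁ h) ts | Δc-* (h t) (e₁ g) ts | Δc-* (g₀ t) (e₂ g h) ts
        | Δc-e₁ g ts | Δc-e₁ h ts | Δc-e₂ g h ts =
  lemma (g t) (h t) (g₀ t) (𝒟 g t) (𝒟 h t) (e₁ g ts) (e₁ h ts) (e₁ (𝒟 g) ts) (e₁ (𝒟 h) ts)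
    (e₂ g h ts) (e₂ (𝒟 g) h ts) (e₂ g (𝒟 h) ts)
  where
  lemma : ∀ a b c δa δb u v δu δv w w₁ w₂ →
    ((δa * v + δb * u) + + 0 * w) + ((a * δv + b * δu) + c * (w₁ + w₂))
      ≡ (δa * v + b * δu + c * w₁) + (a * δv + δb * u + c * w₂)
  lemma = solve-∀

X-+ : ∀ n F G → X n (λ ts → F ts + G ts) ≡ X n F + X n G
X-+ n F G = ∑-+ (F ∘ types) (G ∘ types) (perms n)

X-* : ∀ n k F → X n (λ ts → k * F ts) ≡ k * X n F
X-* n k F = ∑-* k (F ∘ types) (perms n)

X-cong : ∀ n {F G} → (∀ ts → F ts ≡ G ts) → X n F ≡ X n G
X-cong n eq = ∑-cong (perms n) (λ {w} _ → eq (types w))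

X-e₀ : ∀ n → X n e₀ ≡ + 1
X-e₀ zero    = refl
X-e₀ (suc n) = trans (X-suc n e₀ e₀-sym) (trans (X-cong n step) (X-e₀ n))
  where
  step : ∀ ts → + 1 * e₀ ts + Δc e₀ ts ≡ e₀ ts
  step ts rewrite Δc-e₀ ts = trans (+-identityʳ _) (ℤₚ.*-identityˡ _)

-- The recursions for `x` and `y` are those of the sums of `e₁` and `e₂` over S_n. Once `X-e₁` and
-- `X-e₂` are known, the cycle side involves no permutations any more.
x : ℕ → (CycleType → ℤ) → ℤ
x zero    g = + 0
x (suc n) g = g fix + x n g + x n (𝒟 g)

y : ℕ → (g h : CycleType → ℤ) → ℤ
y zero    g h = + 0
y (suc n) g h = g fix * x n h + h fix * x n g + y n g h + y n (𝒟 g) h + y n g (𝒟 h)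

X-e₁ : ∀ n g → X n (e₁ g) ≡ x n g
X-e₁ zero    g = refl
X-e₁ (suc n) g = begin
  X (suc n) (e₁ g)                                             ≡⟨ X-suc n (e₁ g) (e₁-sym g) ⟩
  X n (λ ts → g fix * e₀ ts + + 1 * e₁ g ts + Δc (e₁ g) ts)    ≡⟨ X-cong n step ⟩
  X n (λ ts → g fix * e₀ ts + e₁ g ts + e₁ (𝒟 g) ts)           ≡⟨ X-+ n (λ ts → g fix * e₀ ts + e₁ g ts) (e₁ (𝒟 g)) ⟩
  X n (λ ts → g fix * e₀ ts + e₁ g ts) + X n (e₁ (𝒟 g))        ≡⟨ cong (_+ X n (e₁ (𝒟 g))) (X-+ n (λ ts → g fix * e₀ ts) (e₁ g)) ⟩
  X n (λ ts → g fix * e₀ ts) + X n (e₁ g) + X n (e₁ (𝒟 g))     ≡⟨ cong₂ _+_ (cong₂ _+_ scaled (X-e₁ n g)) (X-e₁ n (𝒟 g)) ⟩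
  g fix + x n g + x n (𝒟 g) ∎
  where
  open ≡-Reasoning
  step : ∀ ts → g fix * e₀ ts + + 1 * e₁ g ts + Δc (e₁ g) ts ≡ g fix * e₀ ts + e₁ g ts + e₁ (𝒟 g) ts
  step ts = cong₂ (λ a b → g fix * e₀ ts + a + b) (ℤₚ.*-identityˡ (e₁ g ts)) (Δc-e₁ g ts)
  scaled : X n (λ ts → g fix * e₀ ts) ≡ g fix
  scaled = trans (X-* n (g fix) e₀) (trans (cong (_*_ (g fix)) (X-e₀ n)) (ℤₚ.*-identityʳ (g fix)))

X-e₂ : ∀ n g h → X n (e₂ g h) ≡ y n g h
X-e₂ zero    g h = refl
X-e₂ (suc n) g h = begin
  X (suc n) (e₂ g h)                                                   ≡⟨ X-suc n (e₂ g h) (e₂-sym g h) ⟩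
  X n (λ ts → e₂ g h (fix ∷ ts) + Δc (e₂ g h) ts)                      ≡⟨ X-cong n step ⟩
  X n (λ ts → u ts + v ts + e₂ g h ts + e₂ (𝒟 g) h ts + e₂ g (𝒟 h) ts) ≡⟨ split ⟩
  X n u + X n v + X n (e₂ g h) + X n (e₂ (𝒟 g) h) + X n (e₂ g (𝒟 h))
    ≡⟨ cong₂ _+_ (cong₂ _+_ (cong₂ _+_ (cong₂ _+_ (scale (g fix) h) (scale (h fix) g)) (X-e₂ n g h)) (X-e₂ n (𝒟 g) h)) (X-e₂ n g (𝒟 h)) ⟩
  y (suc n) g h ∎
  where
  open ≡-Reasoning
  u v : List CycleType → ℤ
  u ts = g fix * e₁ h ts
  v ts = h fix * e₁ g ts
  step : ∀ ts → e₂ g h (fix ∷ ts) + Δc (e₂ g h) ts ≡ u ts + v ts + e₂ g h ts + e₂ (𝒟 g) h ts + e₂ g (𝒟 h) ts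
  step ts = trans (cong₂ (λ a b → u ts + v ts + a + b) (ℤₚ.*-identityˡ (e₂ g h ts)) (Δc-e₂ g h ts))
    (sym (+-assoc (u ts + v ts + e₂ g h ts) (e₂ (𝒟 g) h ts) (e₂ g (𝒟 h) ts)))
  split = trans (X-+ n (λ ts → u ts + v ts + e₂ g h ts + e₂ (𝒟 g) h ts) (e₂ g (𝒟 h)))
    (cong (_+ X n (e₂ g (𝒟 h))) (trans (X-+ n (λ ts → u ts + v ts + e₂ g h ts) (e₂ (𝒟 g) h))
      (cong (_+ X n (e₂ (𝒟 g) h)) (trans (X-+ n (λ ts → u ts + v ts) (e₂ g h)) (cong (_+ X n (e₂ g h)) (X-+ n u v))))))
  scale : ∀ k f → X n (λ ts → k * e₁ f ts) ≡ k * x n f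
  scale k f = trans (X-* n k (e₁ f)) (cong (_*_ k) (X-e₁ n f))

-- Permutations with odd cycles

odd : CycleType → Bool
odd fix       = true
odd (cyc x y) = isOdd (x ℕ.+ y)

M : CycleType → ℕ
M fix       = 0
M (cyc x y) = suc (x ℕ.⊓ y)

γ : ℕ → CycleType → ℤ
γ k t = ⟦ odd t ∧ (M t ≡ᵇ k) ⟧

oddWith : ℕ → List CycleType → ℤ
oddWith k ts = ⟦ allB odd ts ∧ (sumL (map M ts) ≡ᵇ k) ⟧

length-types : ∀ {w} c → IsCycle w c → isOdd (length c) ≡ odd (type c) × Mcyc c ≡ M (type c)
length-types c@(h ∷ t) isc with cA c | cD c | cycle-valid c isc | trans (cong₂ ℕ._+_ (cA≡ups h t) (cD≡downs h t)) (ups+downs h h t)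
... | _ | _ | one             | eq = cong isOdd (sym eq) , refl
... | _ | _ | more {x₁} {y₁}  | eq = cong isOdd (trans (sym eq) (cong suc (ℕₚ.+-suc x₁ y₁))) , refl

oddWith-cycles : ∀ {w} k cs → All (IsCycle w) cs →
  ⟦ allB (λ c → isOdd (length c)) cs ∧ (sumL (map Mcyc cs) ≡ᵇ k) ⟧ ≡ oddWith k (map type cs)
oddWith-cycles k cs all with odds all | sums all
  where
  odds : ∀ {w cs} → All (IsCycle w) cs → allB (λ c → isOdd (length c)) cs ≡ allB odd (map type cs)
  odds []       = refl
  odds {cs = c ∷ _} (isc ∷ all) = cong₂ _∧_ (proj₁ (length-types c isc)) (odds all)
  sums : ∀ {w cs} → All (IsCycle w) cs → sumL (map Mcyc cs) ≡ sumL (map M (map type cs))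
  sums []       = refl
  sums {cs = c ∷ _} (isc ∷ all) = cong₂ ℕ._+_ (proj₂ (length-types c isc)) (sums all)
... | eq₁ | eq₂ = cong₂ (λ a m → ⟦ a ∧ (m ≡ᵇ k) ⟧) eq₁ eq₂

p-X : ∀ n k → + p n k ≡ X n (oddWith k)
p-X n k = trans (countPerms-∑ n (λ w → allCyclesOdd w ∧ (Mperm w ≡ᵇ k)))
  (∑-cong (perms n) (λ {w} w∈ → oddWith-cycles k (cycles w) (areCycles (CycleForm-cycles n w∈))))

γ₀≗g₀ : ∀ t → γ 0 t ≡ g₀ t
γ₀≗g₀ fix       = refl
γ₀≗g₀ (cyc x y) with isOdd (x ℕ.+ y)
... | true  = refl
... | false = refl

infixl 8 _⊙_
_⊙_ : Bool × ℕ → ℕ → ℤ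
(a , m) ⊙ k = ⟦ a ∧ (m ≡ᵇ k) ⟧

-- A Cauchy product truncated at degree 2: parity is multiplicative and M additive over cycles.
⊙-+ : ∀ o m a S →
  ((o ∧ a , m ℕ.+ S) ⊙ 0 ≡ (o , m) ⊙ 0 * ((a , S) ⊙ 0)) ×
  ((o ∧ a , m ℕ.+ S) ⊙ 1 ≡ (o , m) ⊙ 1 * ((a , S) ⊙ 0) + (o , m) ⊙ 0 * ((a , S) ⊙ 1)) ×
  ((o ∧ a , m ℕ.+ S) ⊙ 2 ≡ (o , m) ⊙ 2 * ((a , S) ⊙ 0) + (o , m) ⊙ 1 * ((a , S) ⊙ 1) + (o , m) ⊙ 0 * ((a , S) ⊙ 2))
⊙-+ o m a S = go o m ((a , S) ⊙ 0) ((a , S) ⊙ 1) ((a , S) ⊙ 2) refl refl refl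
  where
  Goal : Bool → ℕ → ℤ → ℤ → ℤ → Set
  Goal o m u v w = ((o ∧ a , m ℕ.+ S) ⊙ 0 ≡ (o , m) ⊙ 0 * u) ×
    ((o ∧ a , m ℕ.+ S) ⊙ 1 ≡ (o , m) ⊙ 1 * u + (o , m) ⊙ 0 * v) ×
    ((o ∧ a , m ℕ.+ S) ⊙ 2 ≡ (o , m) ⊙ 2 * u + (o , m) ⊙ 1 * v + (o , m) ⊙ 0 * w)
  l₁ : ∀ u → + 0 ≡ + 0 * u
  l₁ = solve-∀
  l₂ : ∀ u v → + 0 ≡ + 0 * u + + 0 * v
  l₂ = solve-∀
  l₃ : ∀ u v w → + 0 ≡ + 0 * u + + 0 * v + + 0 * w
  l₃ = solve-∀
  r₁ : ∀ u → u ≡ + 1 * u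
  r₁ = solve-∀
  r₂ : ∀ u v → v ≡ + 0 * u + + 1 * v
  r₂ = solve-∀
  r₂′ : ∀ u v → u ≡ + 1 * u + + 0 * v
  r₂′ = solve-∀
  r₃ : ∀ u v w → w ≡ + 0 * u + + 0 * v + + 1 * w
  r₃ = solve-∀
  r₃′ : ∀ u v w → v ≡ + 0 * u + + 1 * v + + 0 * w
  r₃′ = solve-∀
  r₃″ : ∀ u v w → u ≡ + 1 * u + + 0 * v + + 0 * w
  r₃″ = solve-∀
  none : ⟦ a ∧ false ⟧ ≡ + 0
  none = cong ⟦_⟧ (∧-zeroʳ a)
  go : ∀ o m u v w → (a , S) ⊙ 0 ≡ u → (a , S) ⊙ 1 ≡ v → (a , S) ⊙ 2 ≡ w → Goal o m u v w
  go false m u v w p q r = l₁ u , l₂ u v , l₃ u v w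
  go true 0 u v w p q r = trans p (r₁ u) , trans q (r₂ u v) , trans r (r₃ u v w)
  go true 1 u v w p q r = trans none (l₁ u) , trans p (r₂′ u v) , trans q (r₃′ u v w)
  go true 2 u v w p q r = trans none (l₁ u) , trans none (l₂ u v) , trans p (r₃″ u v w)
  go true (suc (suc (suc m))) u v w p q r = trans none (l₁ u) , trans none (l₂ u v) , trans none (l₃ u v w)

-- A total of 2 is one cycle with M = 2 or two cycles with M = 1. Since `e₂ (γ 1) (γ 1)` meets each
-- such pair in both orders, the identity is doubled.
oddWith-e : ∀ ts → (oddWith 0 ts ≡ e₀ ts) × (oddWith 1 ts ≡ e₁ (γ 1) ts) ×
  (+ 2 * oddWith 2 ts ≡ + 2 * e₁ (γ 2) ts + e₂ (γ 1) (γ 1) ts)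
oddWith-e []       = refl , refl , refl
oddWith-e (t ∷ ts) with oddWith-e ts | ⊙-+ (odd t) (M t) (allB odd ts) (sumL (map M ts))
... | i₀ , i₁ , i₂ | q₀ , q₁ , q₂ =
    trans q₀ (cong₂ _*_ (γ₀≗g₀ t) i₀)
  , trans q₁ (cong₂ _+_ (cong (_*_ (γ 1 t)) i₀) (cong₂ _*_ (γ₀≗g₀ t) i₁))
  , trans (cong (_*_ (+ 2)) q₂) (trans
      (lemma₁ (γ 2 t) (γ 1 t) (γ 0 t) (oddWith 0 ts) (oddWith 1 ts) (oddWith 2 ts))
      (trans (cong₂ (λ a b → + 2 * (γ 2 t * a + γ 1 t * b) + γ 0 t * (+ 2 * oddWith 2 ts)) i₀ i₁)
      (trans (cong₂ (λ a b → + 2 * (γ 2 t * e₀ ts + γ 1 t * e₁ (γ 1) ts) + a * b) (γ₀≗g₀ t) i₂)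
        (lemma₂ (γ 2 t) (γ 1 t) (g₀ t) (e₀ ts) (e₁ (γ 1) ts) (e₁ (γ 2) ts) (e₂ (γ 1) (γ 1) ts)))))
  where
  lemma₁ : ∀ c b a u v w → + 2 * (c * u + b * v + a * w) ≡ + 2 * (c * u + b * v) + a * (+ 2 * w)
  lemma₁ = solve-∀
  lemma₂ : ∀ c b a u v v′ w → + 2 * (c * u + b * v) + a * (+ 2 * v′ + w) ≡ + 2 * (c * u + a * v′) + (b * v + b * v + a * w)
  lemma₂ = solve-∀

p-xy : ∀ n → + 2 * + p n 2 ≡ + 2 * x n (γ 2) + y n (γ 1) (γ 1)
p-xy n = begin
  + 2 * + p n 2                                          ≡⟨ cong (_*_ (+ 2)) (p-X n 2) ⟩
  + 2 * X n (oddWith 2)                                  ≡⟨ sym (X-* n (+ 2) (oddWith 2)) ⟩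
  X n (λ ts → + 2 * oddWith 2 ts)                        ≡⟨ X-cong n (λ ts → proj₂ (proj₂ (oddWith-e ts))) ⟩
  X n (λ ts → + 2 * e₁ (γ 2) ts + e₂ (γ 1) (γ 1) ts)     ≡⟨ X-+ n (λ ts → + 2 * e₁ (γ 2) ts) (e₂ (γ 1) (γ 1)) ⟩
  X n (λ ts → + 2 * e₁ (γ 2) ts) + X n (e₂ (γ 1) (γ 1))  ≡⟨ cong₂ _+_ (trans (X-* n (+ 2) (e₁ (γ 2))) (cong (_*_ (+ 2)) (X-e₁ n (γ 2)))) (X-e₂ n (γ 1) (γ 1)) ⟩
  + 2 * x n (γ 2) + y n (γ 1) (γ 1) ∎
  where open ≡-Reasoning

-- Recurrences for the cycle statistics

𝒟-lin : ∀ f k g t → 𝒟 (λ u → f u + k * g u) t ≡ 𝒟 f t + k * 𝒟 g t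
𝒟-lin f k g fix         = refl
𝒟-lin f k g (cyc r c) = lemma (+ suc r) (+ suc c) k (f (cyc r (suc c))) (g (cyc r (suc c))) (f (cyc (suc r) c)) (g (cyc (suc r) c))
  where
  lemma : ∀ u v k a b c d → u * (a + k * b) + v * (c + k * d) ≡ (u * a + v * c) + k * (u * b + v * d)
  lemma = solve-∀

x-cong : ∀ n {f g} → (∀ t → f t ≡ g t) → x n f ≡ x n g
x-cong zero    eq = refl
x-cong (suc n) eq = cong₂ _+_ (cong₂ _+_ (eq fix) (x-cong n eq)) (x-cong n (𝒟-cong eq))

x-lin : ∀ n f k g → x n (λ t → f t + k * g t) ≡ x n f + k * x n g
x-lin zero    f k g = sym (trans (ℤₚ.+-identityˡ _) (ℤₚ.*-zeroʳ k))
x-lin (suc n) f k g rewrite x-cong n (𝒟-lin f k g) | x-lin n f k g | x-lin n (𝒟 f) k (𝒟 g) =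
  lemma k (f fix) (g fix) (x n f) (x n g) (x n (𝒟 f)) (x n (𝒟 g))
  where
  lemma : ∀ k a b c d u v → (a + k * b) + (c + k * d) + (u + k * v) ≡ (a + c + u) + k * (b + d + v)
  lemma = solve-∀

y-cong : ∀ n {f g h i} → (∀ t → f t ≡ g t) → (∀ t → h t ≡ i t) → y n f h ≡ y n g i
y-cong zero    eq eq′ = refl
y-cong (suc n) eq eq′ = cong₂ _+_ (cong₂ _+_ (cong₂ _+_ (cong₂ _+_
  (cong₂ _*_ (eq fix) (x-cong n eq′)) (cong₂ _*_ (eq′ fix) (x-cong n eq)))
  (y-cong n eq eq′)) (y-cong n (𝒟-cong eq) eq′)) (y-cong n eq (𝒟-cong eq′))

y-comm : ∀ n g h → y n g h ≡ y n h g
y-comm zero    g h = refl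
y-comm (suc n) g h rewrite y-comm n g h | y-comm n (𝒟 g) h | y-comm n g (𝒟 h) =
  lemma (g fix * x n h) (h fix * x n g) (y n h g) (y n h (𝒟 g)) (y n (𝒟 h) g)
  where
  lemma : ∀ a b c d e → a + b + c + d + e ≡ b + a + c + e + d
  lemma = solve-∀

y-linˡ : ∀ n f k g h → y n (λ t → f t + k * g t) h ≡ y n f h + k * y n g h
y-linˡ zero    f k g h = sym (trans (ℤₚ.+-identityˡ _) (ℤₚ.*-zeroʳ k))
y-linˡ (suc n) f k g h
  rewrite y-cong n {h = h} (𝒟-lin f k g) (λ _ → refl) | x-lin n f k g
        | y-linˡ n f k g h | y-linˡ n (𝒟 f) k (𝒟 g) h | y-linˡ n f k g (𝒟 h) =
  lemma k (f fix) (g fix) (h fix) (x n h) (x n f) (x n g) (y n f h) (y n g h) (y n (𝒟 f) h) (y n (𝒟 g) h) (y n f (𝒟 h)) (y n g (𝒟 h))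
  where
  lemma : ∀ k f g h z u v a b c d e i →
    (f + k * g) * z + h * (u + k * v) + (a + k * b) + (c + k * d) + (e + k * i)
      ≡ (f * z + h * u + a + c + e) + k * (g * z + h * v + b + d + i)
  lemma = solve-∀

y-linʳ : ∀ n f g k h → y n f (λ t → g t + k * h t) ≡ y n f g + k * y n f h
y-linʳ n f g k h = trans (y-comm n f _) (trans (y-linˡ n g k h f)
  (cong₂ (λ a b → a + k * b) (y-comm n g f) (y-comm n h f)))

cancel : ∀ u → u + - + 1 * u ≡ + 0
cancel = solve-∀

x-zero : ∀ n {g} → (∀ t → g t ≡ + 0) → x n g ≡ + 0
-- The zero function is written as `g₀` minus itself, which brings it into the form required by
-- `x-lin`.
x-zero n eq = trans (x-cong n (λ t → trans (eq t) (sym (cancel (g₀ t)))))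
  (trans (x-lin n g₀ (- + 1) g₀) (cancel (x n g₀)))

y-zero : ∀ n g → y n (𝒟 g₀) g ≡ + 0
y-zero n g = trans (y-cong n (λ t → trans (𝒟-g₀ t) (sym (cancel (g₀ t)))) (λ _ → refl))
  (trans (y-linˡ n g₀ (- + 1) g₀ g) (cancel (y n g₀ g)))

-- Exchanging ascents and descents

_ᵀ : (CycleType → ℤ) → CycleType → ℤ
(g ᵀ) fix       = g fix
(g ᵀ) (cyc r c) = g (cyc c r)

𝒟-ᵀ : ∀ g t → 𝒟 (g ᵀ) t ≡ (𝒟 g ᵀ) t
𝒟-ᵀ g fix       = refl
𝒟-ᵀ g (cyc r c) = +-comm (+ suc r * g (cyc (suc c) r)) (+ suc c * g (cyc c (suc r)))

x-ᵀ : ∀ n g → x n (g ᵀ) ≡ x n g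
x-ᵀ zero    g = refl
x-ᵀ (suc n) g = cong₂ (λ a b → g fix + a + b) (x-ᵀ n g) (trans (x-cong n (𝒟-ᵀ g)) (x-ᵀ n (𝒟 g)))

y-ᵀ : ∀ n g h → y n (g ᵀ) h ≡ y n g h
y-ᵀ zero    g h = refl
y-ᵀ (suc n) g h rewrite x-ᵀ n g | y-ᵀ n g h | y-ᵀ n g (𝒟 h)
  | y-cong n {h = h} (𝒟-ᵀ g) (λ _ → refl) | y-ᵀ n (𝒟 g) h = refl

-- Functions supported on cycles with one or two cyclic ascents

row₀ row₁ : (ℕ → ℤ) → CycleType → ℤ
row₀ φ (cyc 0 c) = φ c
row₀ φ _         = + 0
row₁ φ (cyc 1 c) = φ c
row₁ φ _         = + 0

-- A cycle with one ascent comes from a fixed point, or from splitting the single ascent of a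
-- shorter such cycle; splitting a descent would add an ascent.
𝒟-row₀ : ∀ φ t → 𝒟 (row₀ φ) t ≡ row₀ (φ ∘ suc) t + φ 0 * g₀ t
𝒟-row₀ φ fix = lemma (φ 0)
  where
  lemma : ∀ u → u ≡ + 0 + u * + 1
  lemma = solve-∀
𝒟-row₀ φ (cyc zero c) = lemma (φ (suc c)) (+ suc c) (φ 0)
  where
  lemma : ∀ u v w → + 1 * u + v * + 0 ≡ u + w * + 0
  lemma = solve-∀
𝒟-row₀ φ (cyc (suc r) c) = lemma (+ suc (suc r)) (+ suc c) (φ 0)
  where
  lemma : ∀ u v w → u * + 0 + v * + 0 ≡ + 0 + w * + 0
  lemma = solve-∀

-- Two ascents arise by splitting any of the c + 1 descents of a cycle with one ascent, or either
-- ascent of a cycle that already has two. The latter is the factor 2.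
𝒟-row₁ : ∀ φ t → 𝒟 (row₁ φ) t ≡ row₀ (λ c → + suc c * φ c) t + + 2 * row₁ (φ ∘ suc) t
𝒟-row₁ φ fix = refl
𝒟-row₁ φ (cyc 0 c) = lemma (+ suc c * φ c)
  where
  lemma : ∀ u → + 1 * + 0 + u ≡ u + + 2 * + 0
  lemma = solve-∀
𝒟-row₁ φ (cyc 1 c) = lemma (φ (suc c)) (+ suc c)
  where
  lemma : ∀ u v → + 2 * u + v * + 0 ≡ + 0 + + 2 * u
  lemma = solve-∀
𝒟-row₁ φ (cyc (suc (suc r)) c) = lemma (+ suc (suc (suc r))) (+ suc c)
  where
  lemma : ∀ u v → u * + 0 + v * + 0 ≡ + 0 + + 2 * + 0
  lemma = solve-∀

row₀-cong : ∀ {φ ψ} → (∀ c → φ c ≡ ψ c) → ∀ t → row₀ φ t ≡ row₀ ψ t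
row₀-cong eq fix             = refl
row₀-cong eq (cyc zero c)    = eq c
row₀-cong eq (cyc (suc r) c) = refl

row₀-lin : ∀ φ k ψ t → row₀ (λ c → φ c + k * ψ c) t ≡ row₀ φ t + k * row₀ ψ t
row₀-lin φ k ψ fix             = sym (trans (ℤₚ.+-identityˡ _) (ℤₚ.*-zeroʳ k))
row₀-lin φ k ψ (cyc zero c)    = refl
row₀-lin φ k ψ (cyc (suc r) c) = sym (trans (ℤₚ.+-identityˡ _) (ℤₚ.*-zeroʳ k))

row₁-zero : ∀ t → row₁ (λ _ → + 0) t ≡ + 0
row₁-zero fix                     = refl
row₁-zero (cyc 0 c)               = refl
row₁-zero (cyc 1 c)               = refl
row₁-zero (cyc (suc (suc r)) c)   = refl

-- Only the identity contributes, once for each of its n fixed points.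
x-g₀ : ∀ n → x n g₀ ≡ + n
x-g₀ zero    = refl
x-g₀ (suc n) rewrite x-g₀ n | x-zero n 𝒟-g₀ = +-identityʳ _

x-row₀ : ∀ n φ → x (suc n) (row₀ φ) ≡ x n (row₀ φ) + (x n (row₀ (φ ∘ suc)) + φ 0 * + n)
x-row₀ n φ = cong₂ _+_ (ℤₚ.+-identityˡ (x n (row₀ φ))) (trans (x-cong n (𝒟-row₀ φ))
  (trans (x-lin n (row₀ (φ ∘ suc)) (φ 0) g₀) (cong (λ u → x n (row₀ (φ ∘ suc)) + φ 0 * u) (x-g₀ n))))

x-row₁ : ∀ n φ → x (suc n) (row₁ φ) ≡ x n (row₁ φ) + (x n (row₀ (λ c → + suc c * φ c)) + + 2 * x n (row₁ (φ ∘ suc)))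
x-row₁ n φ = cong₂ _+_ (ℤₚ.+-identityˡ (x n (row₁ φ))) (trans (x-cong n (𝒟-row₁ φ))
  (x-lin n (row₀ (λ c → + suc c * φ c)) (+ 2) (row₁ (φ ∘ suc))))

y-g₀-g₀ : ∀ n → y (suc n) g₀ g₀ ≡ + 2 * + n + y n g₀ g₀
y-g₀-g₀ n rewrite x-g₀ n | y-comm n g₀ (𝒟 g₀) | y-zero n g₀ = lemma (+ n) (y n g₀ g₀)
  where
  lemma : ∀ u v → + 1 * u + + 1 * u + v + + 0 + + 0 ≡ + 2 * u + v
  lemma = solve-∀

y-g₀-row₀ : ∀ n φ → y (suc n) g₀ (row₀ φ) ≡
  x n (row₀ φ) + y n g₀ (row₀ φ) + (y n g₀ (row₀ (φ ∘ suc)) + φ 0 * y n g₀ g₀)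
y-g₀-row₀ n φ rewrite y-zero n (row₀ φ) | y-cong n {f = g₀} (λ _ → refl) (𝒟-row₀ φ)
  | y-linʳ n g₀ (row₀ (φ ∘ suc)) (φ 0) g₀ = 
  lemma (x n (row₀ φ)) (x n g₀) (y n g₀ (row₀ φ)) (y n g₀ (row₀ (φ ∘ suc)) + φ 0 * y n g₀ g₀)
  where
  lemma : ∀ u v w z → + 1 * u + + 0 * v + w + + 0 + z ≡ u + w + z
  lemma = solve-∀

y-row₀-row₀ : ∀ n φ ψ → y (suc n) (row₀ φ) (row₀ ψ) ≡ y n (row₀ φ) (row₀ ψ)
  + (y n (row₀ (φ ∘ suc)) (row₀ ψ) + φ 0 * y n g₀ (row₀ ψ))
  + (y n (row₀ φ) (row₀ (ψ ∘ suc)) + ψ 0 * y n g₀ (row₀ φ))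
y-row₀-row₀ n φ ψ
  rewrite y-cong n {h = row₀ ψ} (𝒟-row₀ φ) (λ _ → refl) | y-linˡ n (row₀ (φ ∘ suc)) (φ 0) g₀ (row₀ ψ)
        | y-cong n {f = row₀ φ} (λ _ → refl) (𝒟-row₀ ψ) | y-linʳ n (row₀ φ) (row₀ (ψ ∘ suc)) (ψ 0) g₀
        | y-comm n (row₀ φ) g₀ = 
  lemma (x n (row₀ φ)) (x n (row₀ ψ)) (y n (row₀ φ) (row₀ ψ))
    (y n (row₀ (φ ∘ suc)) (row₀ ψ) + φ 0 * y n g₀ (row₀ ψ))
    (y n (row₀ φ) (row₀ (ψ ∘ suc)) + ψ 0 * y n g₀ (row₀ φ))
  where
  lemma : ∀ u v w z t → + 0 * v + + 0 * u + w + z + t ≡ w + z + t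
  lemma = solve-∀

-- Closed forms for the cycle statistics

-- In this form composition with `suc` exchanges the two definitionally, so the row recurrences
-- couple them without any rewriting.
ev od : ℕ → ℤ
ev c = ⟦ isOdd (suc c) ⟧
od c = ⟦ isOdd c ⟧

-- The rows A are what M = 2 requires. The coefficient `+ suc c` in `𝒟-row₁` brings in the weighted
-- rows C together with the plain rows B, and the family is then closed up to multiples of `g₀`.
B₀ B₁ C₀ C₁ A₀ A₁ : CycleType → ℤ
B₀ = row₀ ev
B₁ = row₀ od
C₀ = row₀ (λ c → + c * ev c)
C₁ = row₀ (λ c → + c * od c)
A₀ = row₁ ev
A₁ = row₁ od

2^_ 3^_ -1^_ : ℕ → ℤ
2^ n  = (+ 2) ^ n
3^ n  = (+ 3) ^ n
-1^ n = (- + 1) ^ n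

cong₃ : ∀ {A B C D : Set} (f : A → B → C → D) {a a′ b b′ c c′} → a ≡ a′ → b ≡ b′ → c ≡ c′ → f a b c ≡ f a′ b′ c′
cong₃ f refl refl refl = refl

suc-* : ∀ c u → + suc c * u ≡ + c * u + + 1 * u
suc-* c u = lemma (+ c) u
  where
  lemma : ∀ c u → (+ 1 + c) * u ≡ c * u + + 1 * u
  lemma = solve-∀

x-suc-* : ∀ n φ → x n (row₀ (λ c → + suc c * φ c)) ≡ x n (row₀ (λ c → + c * φ c)) + + 1 * x n (row₀ φ)
x-suc-* n φ = trans (x-cong n (λ t → trans (row₀-cong (λ c → suc-* c (φ c)) t) (row₀-lin (λ c → + c * φ c) (+ 1) φ t)))
  (x-lin n (row₀ (λ c → + c * φ c)) (+ 1) (row₀ φ))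

-- The homogeneous step is identity plus parity exchange, with eigenvalues 2 and 0. The eigenvalue 0
-- makes the difference of the pair depend on the previous step only, a transient that `xC-closed`
-- inherits: its formulas fail at n = 1, whence the common start at n = 2.
xB-closed : ∀ m → let n = 2 ℕ.+ m in
  (+ 2 * x n B₁ ≡ 2^ n - + 2 * + n) × (+ 2 * x n B₀ ≡ 2^ n - + 2)
xB-closed zero    = refl , refl
xB-closed (suc m) with xB-closed m
... | i₁ , i₀ =
    trans (cong (_*_ (+ 2)) (x-row₀ n od)) (trans (s₁ (x n B₁) (x n B₀) (+ n)) (trans (cong₂ _+_ i₁ i₀) (r₁ (+ n) (2^ n))))
  , trans (cong (_*_ (+ 2)) (x-row₀ n ev)) (trans (s₀ (x n B₁) (x n B₀) (+ n))
      (trans (cong₂ (λ u v → u + v + + 2 * + n) i₁ i₀) (r₀ (+ n) (2^ n))))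
  where
  n = 2 ℕ.+ m
  s₁ : ∀ u v n → + 2 * (u + (v + + 0 * n)) ≡ + 2 * u + + 2 * v
  s₁ = solve-∀
  r₁ : ∀ n s → (s - + 2 * n) + (s - + 2) ≡ + 2 * s - + 2 * (+ 1 + n)
  r₁ = solve-∀
  s₀ : ∀ u v n → + 2 * (v + (u + + 1 * n)) ≡ + 2 * u + + 2 * v + + 2 * n
  s₀ = solve-∀
  r₀ : ∀ n s → (s - + 2 * n) + (s - + 2) + + 2 * n ≡ + 2 * s - + 2
  r₀ = solve-∀

xC-closed : ∀ m → let n = 2 ℕ.+ m in
  (+ 4 * x n C₁ ≡ + 4 * + n - + 4 * 2^ n + + n * 2^ n) × (+ 4 * x n C₀ ≡ + 8 - + 4 * 2^ n + + n * 2^ n)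
xC-closed zero    = refl , refl
xC-closed (suc m) with xC-closed m | xB-closed m
... | i₁ , i₀ | j₁ , j₀ =
    trans (cong (_*_ (+ 4)) (trans (x-row₀ n (λ c → + c * od c)) (cong (λ u → x n C₁ + (u + + 0 * + n)) (x-suc-* n ev))))
      (trans (s (x n C₁) (x n C₀) (x n B₀) (+ n)) (trans (cong₃ (λ u v w → u + v + + 2 * w) i₁ i₀ j₀) (r₁ (+ n) (2^ n))))
  , trans (cong (_*_ (+ 4)) (trans (x-row₀ n (λ c → + c * ev c)) (cong (λ u → x n C₀ + (u + + 0 * + n)) (x-suc-* n od))))
      (trans (s (x n C₀) (x n C₁) (x n B₁) (+ n)) (trans (cong₃ (λ u v w → u + v + + 2 * w) i₀ i₁ j₁) (r₀ (+ n) (2^ n))))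
  where
  n = 2 ℕ.+ m
  s : ∀ u v w n → + 4 * (u + ((v + + 1 * w) + + 0 * n)) ≡ + 4 * u + + 4 * v + + 2 * (+ 2 * w)
  s = solve-∀
  r₁ : ∀ n s → (+ 4 * n - + 4 * s + n * s) + (+ 8 - + 4 * s + n * s) + + 2 * (s - + 2)
    ≡ + 4 * (+ 1 + n) - + 4 * (+ 2 * s) + (+ 1 + n) * (+ 2 * s)
  r₁ = solve-∀
  r₀ : ∀ n s → (+ 8 - + 4 * s + n * s) + (+ 4 * n - + 4 * s + n * s) + + 2 * (s - + 2 * n)
    ≡ + 8 - + 4 * (+ 2 * s) + (+ 1 + n) * (+ 2 * s)
  r₀ = solve-∀

-- Here the homogeneous step is identity plus twice the parity exchange, with eigenvalues 3 and -1;
-- C and B enter as inhomogeneous terms.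
xA-closed : ∀ m → let n = 2 ℕ.+ m in
  (+ 4 * x n A₁ ≡ 3^ n + -1^ n - + 2 - + n * 2^ n) × (+ 4 * x n A₀ ≡ 3^ n - -1^ n - + n * 2^ n)
xA-closed zero    = refl , refl
xA-closed (suc m) with xA-closed m | xC-closed m | xB-closed m
... | i₁ , i₀ | k₁ , k₀ | j₁ , j₀ =
    trans (cong (_*_ (+ 4)) (trans (x-row₁ n od) (cong (λ u → x n A₁ + (u + + 2 * x n A₀)) (x-suc-* n od))))
      (trans (s (x n A₁) (x n A₀) (x n C₁) (x n B₁)) (trans (cong₂ (λ a b → a + b) (cong₂ (λ a b → a + + 2 * b) i₁ i₀)
        (cong₂ (λ a b → a + + 2 * b) k₁ j₁)) (r₁ (+ n) (2^ n) (3^ n) (-1^ n))))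
  , trans (cong (_*_ (+ 4)) (trans (x-row₁ n ev) (cong (λ u → x n A₀ + (u + + 2 * x n A₁)) (x-suc-* n ev))))
      (trans (s (x n A₀) (x n A₁) (x n C₀) (x n B₀)) (trans (cong₂ (λ a b → a + b) (cong₂ (λ a b → a + + 2 * b) i₀ i₁)
        (cong₂ (λ a b → a + + 2 * b) k₀ j₀)) (r₀ (+ n) (2^ n) (3^ n) (-1^ n))))
  where
  n = 2 ℕ.+ m
  s : ∀ u v w z → + 4 * (u + ((w + + 1 * z) + + 2 * v)) ≡ (+ 4 * u + + 2 * (+ 4 * v)) + (+ 4 * w + + 2 * (+ 2 * z))
  s = solve-∀
  r₁ : ∀ n s t e → ((t + e - + 2 - n * s) + + 2 * (t - e - n * s)) + ((+ 4 * n - + 4 * s + n * s) + + 2 * (s - + 2 * n))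
    ≡ + 3 * t + - + 1 * e - + 2 - (+ 1 + n) * (+ 2 * s)
  r₁ = solve-∀
  r₀ : ∀ n s t e → ((t - e - n * s) + + 2 * (t + e - + 2 - n * s)) + ((+ 8 - + 4 * s + n * s) + + 2 * (s - + 2))
    ≡ + 3 * t - - + 1 * e - (+ 1 + n) * (+ 2 * s)
  r₀ = solve-∀

-- Ordered pairs of distinct fixed points of the identity.
yg₀-closed : ∀ n → y n g₀ g₀ ≡ + n * + n - + n
yg₀-closed zero    = refl
yg₀-closed (suc n) rewrite y-g₀-g₀ n | yg₀-closed n = r (+ n)
  where
  r : ∀ n → + 2 * n + (n * n - n) ≡ (+ 1 + n) * (+ 1 + n) - (+ 1 + n)
  r = solve-∀

yg₀B-closed : ∀ m → let n = 2 ℕ.+ m in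
  (+ 4 * y n g₀ B₁ ≡ + 4 * + n - + 4 * (+ n * + n) + + n * 2^ n) × (+ 4 * y n g₀ B₀ ≡ + n * 2^ n - + 4 * + n)
yg₀B-closed zero    = refl , refl
yg₀B-closed (suc m) with yg₀B-closed m | xB-closed m
... | i₁ , i₀ | j₁ , j₀ =
    trans (cong (_*_ (+ 4)) (y-g₀-row₀ n od)) (trans (s₁ (x n B₁) (y n g₀ B₁) (y n g₀ B₀) (y n g₀ g₀))
      (trans (cong₃ (λ a b c → + 2 * a + b + c) j₁ i₁ i₀) (r₁ (+ n) (2^ n))))
  , trans (cong (_*_ (+ 4)) (y-g₀-row₀ n ev)) (trans (s₀ (x n B₀) (y n g₀ B₁) (y n g₀ B₀) (y n g₀ g₀))
      (trans (cong₂ _+_ (cong₃ (λ a b c → + 2 * a + b + c) j₀ i₁ i₀) (cong (_*_ (+ 4)) (yg₀-closed n))) (r₀ (+ n) (2^ n))))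
  where
  n = 2 ℕ.+ m
  s₁ : ∀ u v w z → + 4 * (u + v + (w + + 0 * z)) ≡ + 2 * (+ 2 * u) + + 4 * v + + 4 * w
  s₁ = solve-∀
  r₁ : ∀ n s → + 2 * (s - + 2 * n) + (+ 4 * n - + 4 * (n * n) + n * s) + (n * s - + 4 * n)
    ≡ + 4 * (+ 1 + n) - + 4 * ((+ 1 + n) * (+ 1 + n)) + (+ 1 + n) * (+ 2 * s)
  r₁ = solve-∀
  s₀ : ∀ u v w z → + 4 * (u + w + (v + + 1 * z)) ≡ + 2 * (+ 2 * u) + + 4 * v + + 4 * w + + 4 * z
  s₀ = solve-∀
  r₀ : ∀ n s → + 2 * (s - + 2) + (+ 4 * n - + 4 * (n * n) + n * s) + (n * s - + 4 * n) + + 4 * (n * n - n)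
    ≡ (+ 1 + n) * (+ 2 * s) - + 4 * (+ 1 + n)
  r₀ = solve-∀

-- Parity can be exchanged in either of the two cycles, so identity plus both exchanges has
-- eigenvalues 3, 1, 1 and -1. The mixed value is needed to close the system, although only the
-- odd-odd one enters p.
yB-closed : ∀ m → let n = 2 ℕ.+ m in
  (+ 4 * y n B₁ B₁ ≡ 3^ n + -1^ n - + 2 * (+ n * 2^ n) + + 4 * (+ n * + n) - + 4 * + n - + 2) ×
  (+ 4 * y n B₀ B₁ ≡ 3^ n - -1^ n - + n * 2^ n - + 2 * 2^ n + + 4 * + n) ×
  (+ 4 * y n B₀ B₀ ≡ 3^ n + -1^ n - + 4 * 2^ n + + 6)
yB-closed zero    = refl , refl , refl
yB-closed (suc m) with yB-closed m | yg₀B-closed m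
... | i₁₁ , i₀₁ , i₀₀ | j₁ , j₀ =
    trans (cong (_*_ (+ 4)) (trans (y-row₀-row₀ n od od)
        (cong (λ u → y n B₁ B₁ + (y n B₀ B₁ + + 0 * y n g₀ B₁) + (u + + 0 * y n g₀ B₁)) (y-comm n B₁ B₀))))
      (trans (s₁₁ (y n B₁ B₁) (y n B₀ B₁) (y n g₀ B₁)) (trans (cong₂ (λ a b → a + + 2 * b) i₁₁ i₀₁) (r₁₁ (+ n) (2^ n) (3^ n) (-1^ n))))
  , trans (cong (_*_ (+ 4)) (y-row₀-row₀ n ev od))
      (trans (s₀₁ (y n B₁ B₁) (y n B₀ B₁) (y n B₀ B₀) (y n g₀ B₁) (y n g₀ B₀))
        (trans (cong₂ _+_ (cong₃ (λ a b c → a + b + c) i₁₁ i₀₁ i₀₀) j₁) (r₀₁ (+ n) (2^ n) (3^ n) (-1^ n))))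
  , trans (cong (_*_ (+ 4)) (trans (y-row₀-row₀ n ev ev)
        (cong (λ u → y n B₀ B₀ + (u + + 1 * y n g₀ B₀) + (y n B₀ B₁ + + 1 * y n g₀ B₀)) (y-comm n B₁ B₀))))
      (trans (s₀₀ (y n B₀ B₁) (y n B₀ B₀) (y n g₀ B₀))
        (trans (cong₃ (λ a b c → a + + 2 * b + + 2 * c) i₀₀ i₀₁ j₀) (r₀₀ (+ n) (2^ n) (3^ n) (-1^ n))))
  where
  n = 2 ℕ.+ m
  s₁₁ : ∀ u v w → + 4 * (u + (v + + 0 * w) + (v + + 0 * w)) ≡ + 4 * u + + 2 * (+ 4 * v)
  s₁₁ = solve-∀
  r₁₁ : ∀ n s t e → (t + e - + 2 * (n * s) + + 4 * (n * n) - + 4 * n - + 2) + + 2 * (t - e - n * s - + 2 * s + + 4 * n)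
    ≡ + 3 * t + - + 1 * e - + 2 * ((+ 1 + n) * (+ 2 * s)) + + 4 * ((+ 1 + n) * (+ 1 + n)) - + 4 * (+ 1 + n) - + 2
  r₁₁ = solve-∀
  s₀₁ : ∀ u v w z₁ z₀ → + 4 * (v + (u + + 1 * z₁) + (w + + 0 * z₀)) ≡ + 4 * u + + 4 * v + + 4 * w + + 4 * z₁
  s₀₁ = solve-∀
  r₀₁ : ∀ n s t e → (t + e - + 2 * (n * s) + + 4 * (n * n) - + 4 * n - + 2) + (t - e - n * s - + 2 * s + + 4 * n)
    + (t + e - + 4 * s + + 6) + (+ 4 * n - + 4 * (n * n) + n * s)
    ≡ + 3 * t - - + 1 * e - (+ 1 + n) * (+ 2 * s) - + 2 * (+ 2 * s) + + 4 * (+ 1 + n)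
  r₀₁ = solve-∀
  s₀₀ : ∀ v w z → + 4 * (w + (v + + 1 * z) + (v + + 1 * z)) ≡ + 4 * w + + 2 * (+ 4 * v) + + 2 * (+ 4 * z)
  s₀₀ = solve-∀
  r₀₀ : ∀ n s t e → (t + e - + 4 * s + + 6) + + 2 * (t - e - n * s - + 2 * s + + 4 * n) + + 2 * (n * s - + 4 * n)
    ≡ + 3 * t + - + 1 * e - + 4 * (+ 2 * s) + + 6
  r₀₀ = solve-∀

atZero : ℕ → ℤ
atZero zero    = + 1
atZero (suc _) = + 0

-- The 3-cycles with two ascents, which row₁ ev counts although their M is 1.
T₃ : CycleType → ℤ
T₃ = row₁ atZero

-- Multiples of the numbers of transpositions and of 3-cycles with two ascents, that is of C(n,2)
-- and C(n,3): a set of three elements carries exactly one such 3-cycle.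
xT-closed : ∀ n → (+ 2 * x n (row₀ atZero) ≡ + n * + n - + n) ×
  (+ 6 * x n T₃ ≡ + n * + n * + n - + 3 * (+ n * + n) + + 2 * + n)
xT-closed zero    = refl , refl
xT-closed (suc n) with xT-closed n
... | i , j =
    trans (cong (_*_ (+ 2)) (trans (x-row₀ n atZero) (cong (λ u → x n (row₀ atZero) + (u + + 1 * + n)) (x-zero n row₀-zero))))
      (trans (s (x n (row₀ atZero)) (+ n)) (trans (cong (λ u → u + + 2 * + n) i) (r (+ n))))
  , trans (cong (_*_ (+ 6)) (trans (x-row₁ n atZero)
        (cong₂ (λ u v → x n T₃ + (u + + 2 * v)) (x-cong n (row₀-cong suc-atZero)) (x-zero n row₁-zero))))
      (trans (s′ (x n T₃) (x n (row₀ atZero))) (trans (cong₂ (λ u v → u + + 3 * v) j i) (r′ (+ n))))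
  where
  row₀-zero : ∀ t → row₀ (λ _ → + 0) t ≡ + 0
  row₀-zero fix             = refl
  row₀-zero (cyc zero c)    = refl
  row₀-zero (cyc (suc r) c) = refl
  suc-atZero : ∀ c → + suc c * atZero c ≡ atZero c
  suc-atZero zero    = refl
  suc-atZero (suc c) = ℤₚ.*-zeroʳ (+ suc (suc c))
  s : ∀ u n → + 2 * (u + (+ 0 + + 1 * n)) ≡ + 2 * u + + 2 * n
  s = solve-∀
  r : ∀ n → (n * n - n) + + 2 * n ≡ (+ 1 + n) * (+ 1 + n) - (+ 1 + n)
  r = solve-∀
  s′ : ∀ u v → + 6 * (u + (v + + 2 * + 0)) ≡ + 6 * u + + 3 * (+ 2 * v)
  s′ = solve-∀
  r′ : ∀ n → (n * n * n - + 3 * (n * n) + + 2 * n) + + 3 * (n * n - n)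
    ≡ (+ 1 + n) * (+ 1 + n) * (+ 1 + n) - + 3 * ((+ 1 + n) * (+ 1 + n)) + + 2 * (+ 1 + n)
  r′ = solve-∀

-- M = 1 means a single ascent or a single descent. The overlap, the transposition type `cyc 0 0`,
-- has even length and is invisible to `od`.
γ₁-rows : ∀ t → γ 1 t ≡ B₁ t + + 1 * (B₁ ᵀ) t
γ₁-rows fix                     = refl
γ₁-rows (cyc zero zero)         = refl
γ₁-rows (cyc zero (suc c))      rewrite ∧-identityʳ (isOdd (suc c)) = sym (+-identityʳ _)
γ₁-rows (cyc (suc r) zero)      rewrite ℕₚ.+-identityʳ r | ∧-identityʳ (isOdd (suc r)) =
  sym (trans (ℤₚ.+-identityˡ _) (ℤₚ.*-identityˡ _))
γ₁-rows (cyc (suc r) (suc c))   rewrite ∧-zeroʳ (isOdd (suc r ℕ.+ suc c)) = refl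

-- Two ascents or two descents, of odd length. The overlap `cyc 1 1` has even length and drops out;
-- the 3-cycles, where the other count is 1, are subtracted.
γ₂-rows : ∀ t → γ 2 t ≡ A₀ t + + 1 * (A₀ ᵀ) t + - + 1 * T₃ t + - + 1 * (T₃ ᵀ) t
γ₂-rows fix                       = refl
γ₂-rows (cyc 0 0)                 = refl
γ₂-rows (cyc 0 1)                 = refl
γ₂-rows (cyc 0 (suc (suc c)))     rewrite ∧-zeroʳ (isOdd c) = refl
γ₂-rows (cyc 1 0)                 = refl
γ₂-rows (cyc 1 1)                 = refl
γ₂-rows (cyc 1 (suc (suc c)))     rewrite ∧-identityʳ (isOdd (suc c)) = lemma ⟦ isOdd (suc c) ⟧
  where
  lemma : ∀ u → u ≡ u + + 1 * + 0 + - + 1 * + 0 + - + 1 * + 0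
  lemma = solve-∀
γ₂-rows (cyc (suc (suc r)) 0)     rewrite ∧-zeroʳ (isOdd (r ℕ.+ 0)) = refl
γ₂-rows (cyc (suc (suc r)) 1)     rewrite ℕₚ.+-comm r 1 | ∧-identityʳ (isOdd (suc r)) = lemma ⟦ isOdd (suc r) ⟧
  where
  lemma : ∀ u → u ≡ + 0 + + 1 * u + - + 1 * + 0 + - + 1 * + 0
  lemma = solve-∀
γ₂-rows (cyc (suc (suc r)) (suc (suc c))) rewrite ∧-zeroʳ (isOdd (r ℕ.+ suc (suc c))) = refl

x-γ₂ : ∀ n → x n (γ 2) ≡ + 2 * x n A₀ - + 2 * x n T₃
x-γ₂ n = begin
  x n (γ 2)
    ≡⟨ x-cong n γ₂-rows ⟩
  x n (λ t → A₀ t + + 1 * (A₀ ᵀ) t + - + 1 * T₃ t + - + 1 * (T₃ ᵀ) t)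
    ≡⟨ x-lin n (λ t → A₀ t + + 1 * (A₀ ᵀ) t + - + 1 * T₃ t) (- + 1) (T₃ ᵀ) ⟩
  x n (λ t → A₀ t + + 1 * (A₀ ᵀ) t + - + 1 * T₃ t) + - + 1 * x n (T₃ ᵀ)
    ≡⟨ cong₂ (λ u v → u + - + 1 * v) (x-lin n (λ t → A₀ t + + 1 * (A₀ ᵀ) t) (- + 1) T₃) (x-ᵀ n T₃) ⟩
  x n (λ t → A₀ t + + 1 * (A₀ ᵀ) t) + - + 1 * x n T₃ + - + 1 * x n T₃
    ≡⟨ cong (λ u → u + - + 1 * x n T₃ + - + 1 * x n T₃)
         (trans (x-lin n A₀ (+ 1) (A₀ ᵀ)) (cong (λ u → x n A₀ + + 1 * u) (x-ᵀ n A₀))) ⟩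
  x n A₀ + + 1 * x n A₀ + - + 1 * x n T₃ + - + 1 * x n T₃
    ≡⟨ lemma (x n A₀) (x n T₃) ⟩
  + 2 * x n A₀ - + 2 * x n T₃ ∎
  where
  open ≡-Reasoning
  lemma : ∀ u v → u + + 1 * u + - + 1 * v + - + 1 * v ≡ + 2 * u - + 2 * v
  lemma = solve-∀

y-γ₁ : ∀ n → y n (γ 1) (γ 1) ≡ + 4 * y n B₁ B₁
y-γ₁ n = begin
  y n (γ 1) (γ 1)                    ≡⟨ double (γ 1) ⟩
  + 2 * y n B₁ (γ 1)                 ≡⟨ cong (_*_ (+ 2)) (y-comm n B₁ (γ 1)) ⟩
  + 2 * y n (γ 1) B₁                 ≡⟨ cong (_*_ (+ 2)) (double B₁) ⟩
  + 2 * (+ 2 * y n B₁ B₁)            ≡⟨ sym (ℤₚ.*-assoc (+ 2) (+ 2) (y n B₁ B₁)) ⟩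
  + 4 * y n B₁ B₁ ∎
  where
  open ≡-Reasoning
  lemma : ∀ u → u + + 1 * u ≡ + 2 * u
  lemma = solve-∀
  double : ∀ h → y n (γ 1) h ≡ + 2 * y n B₁ h
  double h = trans (y-cong n γ₁-rows (λ _ → refl)) (trans (y-linˡ n B₁ (+ 1) (B₁ ᵀ) h)
    (trans (cong (λ u → y n B₁ h + + 1 * u) (y-ᵀ n B₁ h)) (lemma (y n B₁ h))))

-- Twelve times the common value, with s and t standing for 2ⁿ and 3ⁿ; 12 is a common multiple of
-- the factors 2, 4 and 6 used in the separate closed forms.
closed : ℤ → ℤ → ℤ → ℤ
closed n s t = + 12 * t - + 18 * (n * s) - + 4 * (n * n * n) + + 36 * (n * n) - + 32 * n - + 12

p-closed : ∀ m → let n = 2 ℕ.+ m in + 12 * + p n 2 ≡ closed (+ n) (2^ n) (3^ n)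
p-closed m = begin
  + 12 * + p n 2                                      ≡⟨ ℤₚ.*-assoc (+ 6) (+ 2) (+ p n 2) ⟩
  + 6 * (+ 2 * + p n 2)                               ≡⟨ cong (_*_ (+ 6)) (p-xy n) ⟩
  + 6 * (+ 2 * x n (γ 2) + y n (γ 1) (γ 1))           ≡⟨ cong₂ (λ u v → + 6 * (+ 2 * u + v)) (x-γ₂ n) (y-γ₁ n) ⟩
  + 6 * (+ 2 * (+ 2 * x n A₀ - + 2 * x n T₃) + + 4 * y n B₁ B₁)
    ≡⟨ split (x n A₀) (x n T₃) (y n B₁ B₁) ⟩
  + 6 * (+ 4 * x n A₀) - + 4 * (+ 6 * x n T₃) + + 6 * (+ 4 * y n B₁ B₁)
    ≡⟨ cong₃ (λ u v w → + 6 * u - + 4 * v + + 6 * w) (proj₂ (xA-closed m)) (proj₂ (xT-closed n)) (proj₁ (yB-closed m)) ⟩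
  _
    ≡⟨ collect (+ n) (2^ n) (3^ n) (-1^ n) ⟩
  closed (+ n) (2^ n) (3^ n) ∎
  where
  open ≡-Reasoning
  n = 2 ℕ.+ m
  split : ∀ a k b → + 6 * (+ 2 * (+ 2 * a - + 2 * k) + + 4 * b) ≡ + 6 * (+ 4 * a) - + 4 * (+ 6 * k) + + 6 * (+ 4 * b)
  split = solve-∀
  collect : ∀ n s t e → + 6 * (t - e - n * s) - + 4 * (n * n * n - + 3 * (n * n) + + 2 * n)
    + + 6 * (t + e - + 2 * (n * s) + + 4 * (n * n) - + 4 * n - + 2)
    ≡ + 12 * t - + 18 * (n * s) - + 4 * (n * n * n) + + 36 * (n * n) - + 32 * n - + 12
  collect = solve-∀

-- Closed forms for the signature statistics

S-d₀ : ∀ m → S m (d 0) ≡ + 1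
S-d₀ zero    = refl
S-d₀ (suc m) = trans (S-suc m (d 0)) (trans (S-cong m (λ s _ → trans (ℤₚ.+-identityˡ _) (Δ′-d₀ s))) (S-d₀ m))

S-d₁ : ∀ m → S m (d 1) ≡ 2^ (suc m) - + 1 - + suc m
S-d₁ zero    = refl
S-d₁ (suc m) = begin
  S (suc m) (d 1)                                            ≡⟨ S-suc m (d 1) ⟩
  S m (Δ (d 1))                                              ≡⟨ S-cong m each ⟩
  S m (λ s → + 2 * d 1 s + + suc m * d 0 s)                  ≡⟨ S-+ m (λ s → + 2 * d 1 s) (λ s → + suc m * d 0 s) ⟩
  S m (λ s → + 2 * d 1 s) + S m (λ s → + suc m * d 0 s)      ≡⟨ cong₂ _+_ (S-* m (+ 2) (d 1)) (S-* m (+ suc m) (d 0)) ⟩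
  + 2 * S m (d 1) + + suc m * S m (d 0)                      ≡⟨ cong₂ (λ u v → + 2 * u + + suc m * v) (S-d₁ m) (S-d₀ m) ⟩
  + 2 * (2^ (suc m) - + 1 - + suc m) + + suc m * + 1         ≡⟨ collect (+ suc m) (2^ (suc m)) ⟩
  2^ (suc (suc m)) - + 1 - + suc (suc m) ∎
  where
  open ≡-Reasoning
  collect : ∀ n s → + 2 * (s - + 1 - n) + n * + 1 ≡ + 2 * s - + 1 - (+ 1 + n)
  collect = solve-∀
  lemma : ∀ a b l → a + (+ 2 * b + l * a) ≡ + 2 * b + (+ 1 + l) * a
  lemma = solve-∀
  each : ∀ s → length s ≡ m → Δ (d 1) s ≡ + 2 * d 1 s + + suc m * d 0 s
  each s refl rewrite Δ′-d₁ s = lemma (d 0 s) (d 1 s) (+ length s)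

S-d₂ : ∀ m → + 2 * S m (d 2) ≡ + suc m + + suc m * + suc m - + 2 * 2^ (suc m) - + 2 * (+ suc m * 2^ (suc m)) + + 2 * 3^ (suc m)
S-d₂ zero    = refl
S-d₂ (suc m) = begin
  + 2 * S (suc m) (d 2)
    ≡⟨ cong (_*_ (+ 2)) (trans (S-suc m (d 2)) (S-cong m {g = λ s → + 3 * d 2 s + + m * d 1 s} (λ { s refl → Δ′-d₂ s }))) ⟩
  + 2 * S m (λ s → + 3 * d 2 s + + m * d 1 s)
    ≡⟨ cong (_*_ (+ 2)) (trans (S-+ m (λ s → + 3 * d 2 s) (λ s → + m * d 1 s)) (cong₂ _+_ (S-* m (+ 3) (d 2)) (S-* m (+ m) (d 1)))) ⟩
  + 2 * (+ 3 * S m (d 2) + + m * S m (d 1))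
    ≡⟨ split (S m (d 2)) (S m (d 1)) (+ m) ⟩
  + 3 * (+ 2 * S m (d 2)) + + 2 * (+ m * S m (d 1))
    ≡⟨ cong₂ (λ u v → + 3 * u + + 2 * (+ m * v)) (S-d₂ m) (S-d₁ m) ⟩
  _
    ≡⟨ collect (+ m) (2^ (suc m)) (3^ (suc m)) ⟩
  + suc (suc m) + + suc (suc m) * + suc (suc m) - + 2 * 2^ (suc (suc m)) - + 2 * (+ suc (suc m) * 2^ (suc (suc m))) + + 2 * 3^ (suc (suc m)) ∎
  where
  open ≡-Reasoning
  split : ∀ u v m → + 2 * (+ 3 * u + m * v) ≡ + 3 * (+ 2 * u) + + 2 * (m * v)
  split = solve-∀
  collect : ∀ m s t →
    + 3 * ((+ 1 + m) + (+ 1 + m) * (+ 1 + m) - + 2 * s - + 2 * ((+ 1 + m) * s) + + 2 * t) + + 2 * (m * (s - + 1 - (+ 1 + m)))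
    ≡ (+ 2 + m) + (+ 2 + m) * (+ 2 + m) - + 2 * (+ 2 * s) - + 2 * ((+ 2 + m) * (+ 2 * s)) + + 2 * (+ 3 * t)
  collect = solve-∀

δD-cong : ∀ {f g} → (∀ s → f s ≡ g s) → ∀ s → δD f s ≡ δD g s
δD-cong eq []      = refl
δD-cong eq (A ∷ s) = refl
δD-cong eq (D ∷ s) = eq s

δA-cong : ∀ {f g} → (∀ s → f s ≡ g s) → ∀ s → δA f s ≡ δA g s
δA-cong eq []      = refl
δA-cong eq (A ∷ s) = eq s
δA-cong eq (D ∷ s) = refl

δA-+ : ∀ f g s → δA (λ t → f t + g t) s ≡ δA f s + δA g s
δA-+ f g []      = refl
δA-+ f g (A ∷ s) = refl
δA-+ f g (D ∷ s) = refl

S-δD : ∀ m {f g} → (∀ s → Δ′ f s ≡ g s) → S (suc m) (δD f) ≡ S m f + S m (δD g)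
S-δD m {f} {g} eq = trans (S-suc m (δD f))
  (trans (S-cong m (λ s _ → cong (_+_ (f s)) (trans (Δ′-δD f s) (δD-cong eq s)))) (S-+ m f (δD g)))

S-δA : ∀ m {f g h} → f [] ≡ + 0 → (∀ s → f (D ∷ s) ≡ h s) → (∀ s → Δ′ f s ≡ g s) →
  S (suc m) (δA f) ≡ S m (δA h) + S m (δA g) + S m (δD h)
S-δA m {f} {g} {h} f[] eqD eq′ = trans (S-suc m (δA f)) (trans (S-cong m each)
  (trans (S-+ m (λ s → δA h s + δA g s) (δD h)) (cong (_+ S m (δD h)) (S-+ m (δA h) (δA g)))))
  where
  each : ∀ s → length s ≡ m → Δ (δA f) s ≡ δA h s + δA g s + δD h s
  each s _ = trans (Δ-δA f s f[]) (cong₂ _+_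
    (trans (δA-cong (λ t → cong₂ _+_ (eqD t) (eq′ t)) s) (δA-+ h g s)) (δD-cong eqD s))

-- Signatures with a prescribed beginning and no further descents

δDd₀ δDδDd₀ : List Bool → ℤ
δDd₀   = δD (d 0)
δDδDd₀ = δD δDd₀

Δ′-δDd₀ : ∀ s → Δ′ δDd₀ s ≡ δDd₀ s
Δ′-δDd₀ s = trans (Δ′-δD (d 0) s) (δD-cong Δ′-d₀ s)

S-D : ∀ m → S (suc m) δDd₀ ≡ + suc m
S-D zero    = refl
S-D (suc m) rewrite S-δD (suc m) {d 0} Δ′-d₀ | S-d₀ (suc m) | S-D m = refl

-- Twice C(n-1,2): the third letter is 1, two others are placed decreasingly before it, and the rest
-- increases.
S-DD : ∀ m → let n = + (2 ℕ.+ m) in + 2 * S (suc m) δDδDd₀ ≡ n * n - + 3 * n + + 2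
S-DD zero    = refl
S-DD (suc m) rewrite S-δD (suc m) {δDd₀} Δ′-δDd₀ | S-D m =
  trans (split (+ m) (S (suc m) δDδDd₀)) (trans (cong (λ u → + 2 * (+ 1 + + m) + u) (S-DD m)) (collect (+ m)))
  where
  split : ∀ m u → + 2 * ((+ 1 + m) + u) ≡ + 2 * (+ 1 + m) + + 2 * u
  split = solve-∀
  collect : ∀ m → + 2 * (+ 1 + m) + ((+ 2 + m) * (+ 2 + m) - + 3 * (+ 2 + m) + + 2) ≡ (+ 3 + m) * (+ 3 + m) - + 3 * (+ 3 + m) + + 2
  collect = solve-∀

S-A : ∀ m → S (suc m) (δA (d 0)) ≡ + 1
S-A m = trans (S-cong (suc m) nonempty) (S-d₀ (suc m))
  where
  nonempty : ∀ s → length s ≡ suc m → δA (d 0) s ≡ d 0 s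
  nonempty (A ∷ s) _ = refl
  nonempty (D ∷ s) _ = refl

-- Twice C(n,2) - 1: the two initial letters may form any pair except {1, 2}, which would give no
-- descent.
S-AD : ∀ m → let n = + (2 ℕ.+ m) in + 2 * S (suc m) (δA δDd₀) ≡ n * n - n - + 2
S-AD zero    = refl
S-AD (suc m) rewrite S-δA (suc m) {δDd₀} {δDd₀} {d 0} refl (λ _ → refl) Δ′-δDd₀ | S-A m | S-D m =
  trans (split (+ m) (S (suc m) (δA δDd₀))) (trans (cong (λ u → + 4 + + 2 * + m + u) (S-AD m)) (collect (+ m)))
  where
  split : ∀ m u → + 2 * (+ 1 + u + (+ 1 + m)) ≡ + 4 + + 2 * m + + 2 * u
  split = solve-∀
  collect : ∀ m → + 4 + + 2 * m + ((+ 2 + m) * (+ 2 + m) - (+ 2 + m) - + 2) ≡ (+ 3 + m) * (+ 3 + m) - (+ 3 + m) - + 2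
  collect = solve-∀

-- The count is n C(n-2,2) - C(n-1,3): leave the first letter free before a word of shape D D A ...
-- A, then discard the words that begin with D D D.
S-ADD : ∀ m → let n = + (2 ℕ.+ m) in
  + 6 * S (suc m) (δA δDδDd₀) ≡ + 2 * (n * n * n) - + 9 * (n * n) + + 7 * n + + 6
S-ADD zero    = refl
S-ADD (suc m) rewrite S-δA (suc m) {δDδDd₀} {δDδDd₀} {δDd₀} refl (λ _ → refl)
    (λ s → trans (Δ′-δD δDd₀ s) (δD-cong Δ′-δDd₀ s)) =
  trans (split (S (suc m) (δA δDd₀)) (S (suc m) (δA δDδDd₀)) (S (suc m) δDδDd₀))
    (trans (cong₃ (λ u v w → + 3 * u + v + + 3 * w) (S-AD m) (S-ADD m) (S-DD m)) (collect (+ (2 ℕ.+ m))))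
  where
  split : ∀ u v w → + 6 * (u + v + w) ≡ + 3 * (+ 2 * u) + + 6 * v + + 3 * (+ 2 * w)
  split = solve-∀
  collect : ∀ n → + 3 * (n * n - n - + 2) + (+ 2 * (n * n * n) - + 9 * (n * n) + + 7 * n + + 6) + + 3 * (n * n - + 3 * n + + 2)
    ≡ + 2 * ((+ 1 + n) * (+ 1 + n) * (+ 1 + n)) - + 9 * ((+ 1 + n) * (+ 1 + n)) + + 7 * (+ 1 + n) + + 6
  collect = solve-∀

S-δDd₁ : ∀ m → let n = 2 ℕ.+ m in
  + 2 * S (suc m) (δD (d 1)) ≡ + 4 * + n - + 2 * (+ n * + n) - + 2 * 2^ n + + n * 2^ n
S-δDd₁ zero    = refl
S-δDd₁ (suc m) = begin
  + 2 * S (2 ℕ.+ m) (δD (d 1))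
    ≡⟨ cong (_*_ (+ 2)) (S-δD (suc m) Δ′-d₁) ⟩
  + 2 * (S (suc m) (d 1) + S (suc m) (δD (λ s → + 2 * d 1 s + + length s * d 0 s)))
    ≡⟨ cong (λ u → + 2 * (S (suc m) (d 1) + u)) (trans (S-cong (suc m) each)
         (trans (S-+ (suc m) (λ s → + 2 * δD (d 1) s) (λ s → + m * δDd₀ s)) (cong₂ _+_ (S-* (suc m) (+ 2) (δD (d 1))) (S-* (suc m) (+ m) δDd₀)))) ⟩
  + 2 * (S (suc m) (d 1) + (+ 2 * S (suc m) (δD (d 1)) + + m * S (suc m) δDd₀))
    ≡⟨ split (S (suc m) (d 1)) (S (suc m) (δD (d 1))) (+ m * S (suc m) δDd₀) ⟩
  + 2 * S (suc m) (d 1) + + 2 * (+ 2 * S (suc m) (δD (d 1))) + + 2 * (+ m * S (suc m) δDd₀)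
    ≡⟨ cong₃ (λ u v w → + 2 * u + + 2 * v + + 2 * (+ m * w)) (S-d₁ (suc m)) (S-δDd₁ m) (S-D m) ⟩
  _
    ≡⟨ collect (+ m) (2^ (2 ℕ.+ m)) ⟩
  + 4 * + (3 ℕ.+ m) - + 2 * (+ (3 ℕ.+ m) * + (3 ℕ.+ m)) - + 2 * 2^ (3 ℕ.+ m) + + (3 ℕ.+ m) * 2^ (3 ℕ.+ m) ∎
  where
  open ≡-Reasoning
  -- Inside `δD` the leading letter is gone, so the length coefficient is m.
  each : ∀ s → length s ≡ suc m → δD (λ s → + 2 * d 1 s + + length s * d 0 s) s ≡ + 2 * δD (d 1) s + + m * δDd₀ s
  each (A ∷ s) _    = sym (trans (ℤₚ.+-identityˡ _) (ℤₚ.*-zeroʳ (+ m)))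
  each (D ∷ s) refl = refl
  split : ∀ u v w → + 2 * (u + (+ 2 * v + w)) ≡ + 2 * u + + 2 * (+ 2 * v) + + 2 * w
  split = solve-∀
  collect : ∀ m s → + 2 * (s - + 1 - (+ 2 + m)) + + 2 * (+ 4 * (+ 2 + m) - + 2 * ((+ 2 + m) * (+ 2 + m)) - + 2 * s + (+ 2 + m) * s)
    + + 2 * (m * (+ 1 + m))
    ≡ + 4 * (+ 3 + m) - + 2 * ((+ 3 + m) * (+ 3 + m)) - + 2 * (+ 2 * s) + (+ 3 + m) * (+ 2 * s)
  collect = solve-∀

b-closed : ∀ m → let n = 2 ℕ.+ m in + 12 * + b n 2 ≡ closed (+ n) (2^ n) (3^ n)
b-closed m = begin
  + 12 * + b n 2
    ≡⟨ split (+ b n 2) (S (suc m) (δD (d 1))) (S (suc m) (δA δDδDd₀)) ⟩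
  + 12 * (+ b n 2 + S (suc m) (δD (d 1)) + S (suc m) (δA δDδDd₀)) - + 6 * (+ 2 * S (suc m) (δD (d 1))) - + 2 * (+ 6 * S (suc m) (δA δDδDd₀))
    ≡⟨ cong (λ u → + 12 * u - + 6 * (+ 2 * S (suc m) (δD (d 1))) - + 2 * (+ 6 * S (suc m) (δA δDδDd₀))) (b-S (suc m)) ⟩
  + 12 * S (suc m) (d 2) - + 6 * (+ 2 * S (suc m) (δD (d 1))) - + 2 * (+ 6 * S (suc m) (δA δDδDd₀))
    ≡⟨ cong (λ u → u - + 6 * (+ 2 * S (suc m) (δD (d 1))) - + 2 * (+ 6 * S (suc m) (δA δDδDd₀))) (ℤₚ.*-assoc (+ 6) (+ 2) (S (suc m) (d 2))) ⟩
  + 6 * (+ 2 * S (suc m) (d 2)) - + 6 * (+ 2 * S (suc m) (δD (d 1))) - + 2 * (+ 6 * S (suc m) (δA δDδDd₀))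
    ≡⟨ cong₃ (λ u v w → + 6 * u - + 6 * v - + 2 * w) (S-d₂ (suc m)) (S-δDd₁ m) (S-ADD m) ⟩
  _
    ≡⟨ collect (+ n) (2^ n) (3^ n) ⟩
  closed (+ n) (2^ n) (3^ n) ∎
  where
  open ≡-Reasoning
  n = 2 ℕ.+ m
  split : ∀ u v w → + 12 * u ≡ + 12 * (u + v + w) - + 6 * (+ 2 * v) - + 2 * (+ 6 * w)
  split = solve-∀
  collect : ∀ n s t → + 6 * (n + n * n - + 2 * s - + 2 * (n * s) + + 2 * t) - + 6 * (+ 4 * n - + 2 * (n * n) - + 2 * s + n * s)
    - + 2 * (+ 2 * (n * n * n) - + 9 * (n * n) + + 7 * n + + 6)
    ≡ + 12 * t - + 18 * (n * s) - + 4 * (n * n * n) + + 36 * (n * n) - + 32 * n - + 12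
  collect = solve-∀

-- Binomial coefficients and the right-hand side of the formula

2C2 : ∀ n → + 2 * + (n C 2) ≡ + n * + n - + n
2C2 zero    = refl
2C2 (suc n) = begin
  + 2 * + (suc n C 2)           ≡⟨ cong (λ c → + 2 * + c) (trans (sym (nCk+nC[k+1]≡[n+1]C[k+1] n 1)) (cong (ℕ._+ (n C 2)) (nC1≡n n))) ⟩
  + 2 * (+ n + + (n C 2))       ≡⟨ ℤₚ.*-distribˡ-+ (+ 2) (+ n) (+ (n C 2)) ⟩
  + 2 * + n + + 2 * + (n C 2)   ≡⟨ cong (λ u → + 2 * + n + u) (2C2 n) ⟩
  + 2 * + n + (+ n * + n - + n) ≡⟨ collect (+ n) ⟩
  + suc n * + suc n - + suc n ∎
  where
  open ≡-Reasoning
  collect : ∀ n → + 2 * n + (n * n - n) ≡ (+ 1 + n) * (+ 1 + n) - (+ 1 + n)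
  collect = solve-∀

6C3 : ∀ n → + 6 * + (n C 3) ≡ + n * + n * + n - + 3 * (+ n * + n) + + 2 * + n
6C3 zero    = refl
6C3 (suc n) = begin
  + 6 * + (suc n C 3)                       ≡⟨ cong (λ c → + 6 * + c) (sym (nCk+nC[k+1]≡[n+1]C[k+1] n 2)) ⟩
  + 6 * (+ (n C 2) + + (n C 3))             ≡⟨ split (+ (n C 2)) (+ (n C 3)) ⟩
  + 3 * (+ 2 * + (n C 2)) + + 6 * + (n C 3) ≡⟨ cong₂ (λ u v → + 3 * u + v) (2C2 n) (6C3 n) ⟩
  _                                         ≡⟨ collect (+ n) ⟩
  + suc n * + suc n * + suc n - + 3 * (+ suc n * + suc n) + + 2 * + suc n ∎
  where
  open ≡-Reasoning
  split : ∀ u v → + 6 * (u + v) ≡ + 3 * (+ 2 * u) + + 6 * v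
  split = solve-∀
  collect : ∀ n → + 3 * (n * n - n) + (n * n * n - + 3 * (n * n) + + 2 * n)
    ≡ (+ 1 + n) * (+ 1 + n) * (+ 1 + n) - + 3 * ((+ 1 + n) * (+ 1 + n)) + + 2 * (+ 1 + n)
  collect = solve-∀

formula-closed : ∀ m → let n = 2 ℕ.+ m in
  + 12 * (+ 3 * + E (suc m) 2 - + 2 * + (n C 3) + + (n C 2) - + 1) ≡ closed (+ n) (2^ n) (3^ n)
formula-closed m = begin
  + 12 * (+ 3 * + E (suc m) 2 - + 2 * + (n C 3) + + (n C 2) - + 1)
    ≡⟨ split (+ E (suc m) 2) (+ (n C 3)) (+ (n C 2)) ⟩
  + 18 * (+ 2 * + E (suc m) 2) - + 4 * (+ 6 * + (n C 3)) + + 6 * (+ 2 * + (n C 2)) - + 12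
    ≡⟨ cong₃ (λ u v w → + 18 * u - + 4 * v + + 6 * w - + 12) (trans (cong (_*_ (+ 2)) (E-S m 2)) (S-d₂ m)) (6C3 n) (2C2 n) ⟩
  _
    ≡⟨ collect (+ m) (2^ (suc m)) (3^ (suc m)) ⟩
  closed (+ n) (2^ n) (3^ n) ∎
  where
  open ≡-Reasoning
  n = 2 ℕ.+ m
  split : ∀ e u v → + 12 * (+ 3 * e - + 2 * u + v - + 1) ≡ + 18 * (+ 2 * e) - + 4 * (+ 6 * u) + + 6 * (+ 2 * v) - + 12
  split = solve-∀
  collect : ∀ m s t → + 18 * ((+ 1 + m) + (+ 1 + m) * (+ 1 + m) - + 2 * s - + 2 * ((+ 1 + m) * s) + + 2 * t)
    - + 4 * ((+ 2 + m) * (+ 2 + m) * (+ 2 + m) - + 3 * ((+ 2 + m) * (+ 2 + m)) + + 2 * (+ 2 + m))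
    + + 6 * ((+ 2 + m) * (+ 2 + m) - (+ 2 + m)) - + 12
    ≡ + 12 * (+ 3 * t) - + 18 * ((+ 2 + m) * (+ 2 * s)) - + 4 * ((+ 2 + m) * (+ 2 + m) * (+ 2 + m))
      + + 36 * ((+ 2 + m) * (+ 2 + m)) - + 32 * (+ 2 + m) - + 12
  collect = solve-∀

theorem1p4 : (n : ℕ) → 2 ≤ n →
    (b n 2 ≡ p n 2) ×
    ((+ p n 2) ≡ (+ 3) * (+ E (Data.Nat._∸_ n 1) 2) - (+ 2) * (+ (n C 3)) + (+ (n C 2)) - (+ 1))
theorem1p4 (suc (suc m)) (s≤s (s≤s _)) =
    ℤₚ.+-injective (ℤₚ.*-cancelˡ-≡ (+ 12) _ _ (trans (b-closed m) (sym (p-closed m))))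
  , ℤₚ.*-cancelˡ-≡ (+ 12) _ _ (trans (p-closed m) (sym (formula-closed m)))
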